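{- Let $a,b,c$ be positive integers with $2\leq a\leq b$, and suppose that either $a,b,c$ are all odd, or $a$ and $b$ are both even with $(a,b)\neq(2,2)$ (and $c$ arbitrary). Then there exists a magic rectangle $MR(ac,bc;b,a)$.
   Context: For positive integers $m,n,r,s$ with $mr=ns$, $r\le n$, $s\le m$, a magic rectangle $MR(m,n;r,s)$ is an $m\times n$ array in which some cells may be empty, each row contains exactly $r$ filled cells, each column contains exactly $s$ filled cells, the filled cells contain the numbers $0,1,\ldots,mr-1$, each exactly once, the sum of the entries of each row is the same for all rows, and the sum of the entries of each column is the same for all columns. -}

module Defs where

open import Data.Nat using (ℕ; zero; suc; _+_; _*_; _≤_; _<_)
open import Data.Fin using (Fin)
open import Data.List using (List; map; allFin)
open import Data.Nat.ListAction using (sum)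
open import Data.Maybe using (Maybe; just; nothing)
open import Data.Product using (Σ; _×_; _,_; ∃)
open import Relation.Binary.PropositionalEquality using (_≡_)

Σ-fin : (n : ℕ) → (Fin n → ℕ) → ℕ
Σ-fin n f = sum (map f (allFin n))

-- A partially filled m × n array of naturals (nothing = empty cell)
Array : ℕ → ℕ → Set
Array m n = Fin m → Fin n → Maybe ℕ

filled : Maybe ℕ → ℕ
filled (just _) = 1
filled nothing  = 0

value : Maybe ℕ → ℕ
value (just x) = x
value nothing  = 0

rowCount : ∀ {m n} → Array m n → Fin m → ℕ
rowCount {n = n} A i = Σ-fin n (λ j → filled (A i j))

colCount : ∀ {m n} → Array m n → Fin n → ℕ
colCount {m = m} A j = Σ-fin m (λ i → filled (A i j))

rowSum : ∀ {m n} → Array m n → Fin m → ℕ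
rowSum {n = n} A i = Σ-fin n (λ j → value (A i j))

colSum : ∀ {m n} → Array m n → Fin n → ℕ
colSum {m = m} A j = Σ-fin m (λ i → value (A i j))

record IsMagicRectangle (m n r s : ℕ) (A : Array m n) : Set where
  field
    rowFilled : ∀ i → rowCount A i ≡ r
    colFilled : ∀ j → colCount A j ≡ s
    inRange   : ∀ i j x → A i j ≡ just x → x < m * r
    occurs    : ∀ x → x < m * r → Σ (Fin m) λ i → Σ (Fin n) λ j → A i j ≡ just x
    once      : ∀ i j i' j' x → A i j ≡ just x → A i' j' ≡ just x → (i ≡ i') × (j ≡ j')
    rowMagic  : ∃ λ ρ → ∀ i → rowSum A i ≡ ρ
    colMagic  : ∃ λ σ → ∀ j → colSum A j ≡ σ

MR : ℕ → ℕ → ℕ → ℕ → Set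
MR m n r s = Σ (Array m n) (IsMagicRectangle m n r s)

Odd : ℕ → Set
Odd k = ∃ λ t → k ≡ suc (2 * t)

Even : ℕ → Set
Even k = ∃ λ t → k ≡ 2 * t

{-# OPTIONS --safe #-}
-- Subtracting the mean turns the task into signed matrices with zero line sums that hit prescribed
-- values; copies are placed along the diagonal. Two rows r, -r with r of sum 0 (a strip) have zero
-- line sums, and strips may be stacked.
--
-- Even a, b: all rows come in strips, and consecutive values are grouped in fours with signs
-- + - - +, after a first group of six if b ≡ 2 mod 4.
--
-- Odd a, b, c: a Kotzig matrix of permutations of [-d, d], c = 2 d + 1, reduces to c = 1. Take
-- triples j + (C - j / 2) = C + j / 2, where C depends on the parity of j only, so that the pairs
-- C ± j / 2 nest and fill intervals. The first (b - 1) / 2 triples and their negatives, with (C, 0, -C),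
-- are the columns of 3 core rows: the columns j and -j cancel in every row, except that 7 columns
-- around j = 0 are permuted by hand. Each remaining pair of rows is a strip made of one triple and
-- of pairs of consecutive numbers. If (b - 1) / 2 is even the number of these pairs is odd and
-- contributes ±1, so j is then matched with a pair of difference j ± 1 instead.
module Submission where

open import Defs
open import Data.Nat using (ℕ; zero; suc; _+_; _*_; _∸_; _≤_; _<_; NonZero; s≤s; z≤n)
import Data.Nat.Properties as ℕ
open import Data.Nat.DivMod using (_/_; m*n/n≡m)
open import Data.Integer using (ℤ; +_; -[1+_]; ∣_∣; 0ℤ) renaming (_+_ to _+ᶻ_; _*_ to _*ᶻ_; -_ to -ᶻ_; _-_ to _-ᶻ_)
import Data.Integer as ℤ using (_⊖_; _≟_; NonZero)
import Data.Integer.Properties as ℤ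
open import Data.Fin using (Fin; zero; suc; toℕ; fromℕ<; splitAt; opposite; combine; remQuot; quotient; remainder; punchOut; _↑ˡ_; _↑ʳ_)
import Data.Fin.Properties as Fin
open import Data.Fin.Patterns
open import Data.List using (tabulate)
open import Data.List.Properties using (map-tabulate)
import Data.Nat.ListAction as List using (sum)
open import Data.Maybe using (Maybe; just; nothing)
open import Data.Product using (∃; ∃₂; _×_; _,_; proj₁; proj₂)
open import Data.Sum using (_⊎_; inj₁; inj₂; [_,_]′)
open import Data.Unit using (⊤; tt)
open import Data.Vec using (Vec; []; _∷_; lookup)
open import Data.Vec.Functional using (Vector; _++_)
open import Data.Vec.Functional.Properties using (lookup-++ˡ; lookup-++ʳ)
open import Function using (_∘_; id)
open import Function.Definitions using (Injective)
open import Relation.Nullary using (¬_; yes; no; contradiction)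
open import Relation.Nullary.Decidable using (True; toWitness; _×-dec_)
open import Relation.Binary.PropositionalEquality
open import Algebra.Bundles using (Semiring)
import Algebra.Properties.Semiring.Sum as SemiringSum
import Algebra.Properties.AbelianGroup as AbelianGroupProperties
open import Data.Integer.Tactic.RingSolver using (solve-∀)
import Data.Nat.Tactic.RingSolver as ℕ-Solver

module ℤ-group = AbelianGroupProperties ℤ.+-0-abelianGroup

-- Finite sums.

module ∑ℕ = SemiringSum ℕ.+-*-semiring
module ∑ℤ = SemiringSum ℤ.+-*-semiring

∑ : ∀ {n} → (Fin n → ℤ) → ℤ
∑ = ∑ℤ.sum

Σ-fin≡sum : ∀ n (f : Fin n → ℕ) → Σ-fin n f ≡ ∑ℕ.sum f
Σ-fin≡sum n f = trans (cong List.sum (map-tabulate id f)) (sum-tabulate n f)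
  where
  sum-tabulate : ∀ n (f : Fin n → ℕ) → List.sum (tabulate f) ≡ ∑ℕ.sum f
  sum-tabulate zero    f = refl
  sum-tabulate (suc n) f = cong (_+_ (f zero)) (sum-tabulate n (f ∘ suc))

+-sum : ∀ {n} (f : Fin n → ℕ) → + ∑ℕ.sum f ≡ ∑ (λ i → + f i)
+-sum {zero}  f = refl
+-sum {suc n} f = cong (_+ᶻ_ (+ f zero)) (+-sum (f ∘ suc))

sum-const : ∀ n (r : ℤ) → ∑ {n} (λ _ → r) ≡ + n *ᶻ r
sum-const zero    r = sym (ℤ.*-zeroˡ r)
sum-const (suc n) r = trans (cong (_+ᶻ_ r) (sum-const n r)) (sym (ℤ.suc-* (+ n) r))

sumℕ-ones : ∀ n → ∑ℕ.sum {n} (λ _ → 1) ≡ n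
sumℕ-ones zero    = refl
sumℕ-ones (suc n) = cong suc (sumℕ-ones n)

module _ {c ℓ} (R : Semiring c ℓ) where
  open Semiring R using (Carrier; _≈_; +-identityˡ; +-congˡ; +-assoc)
    renaming (_+_ to _⊕_; refl to ≈-refl; trans to ≈-trans; sym to ≈-sym)
  open SemiringSum R using (sum)

  sum-split : ∀ m {n} (f : Fin (m + n) → Carrier) →
              sum f ≈ sum (λ i → f (i ↑ˡ n)) ⊕ sum (λ j → f (m ↑ʳ j))
  sum-split zero    f = ≈-sym (+-identityˡ _)
  sum-split (suc m) f = ≈-trans (+-congˡ (sum-split m (f ∘ suc))) (≈-sym (+-assoc _ _ _))

  sum-combine : ∀ m {n} (f : Fin (m * n) → Carrier) →
                sum f ≈ sum (λ i → sum (λ j → f (combine {m} i j)))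
  sum-combine zero    f = ≈-refl
  sum-combine (suc m) {n} f = ≈-trans (sum-split n f) (+-congˡ (sum-combine m (f ∘ (n ↑ʳ_))))

-- Pigeonhole: a missed value `y` could be punched out of the codomain, which would leave an
-- injection into a smaller finite set.
injective⇒surjective : ∀ {n} {f : Fin n → Fin n} → Injective _≡_ _≡_ f → ∀ y → ∃ λ x → f x ≡ y
injective⇒surjective {suc n} {f} inj y with Fin.any? (λ x → f x Fin.≟ y)
... | yes p = p
... | no ¬p = contradiction (Fin.injective⇒≤ punched-inj) (ℕ.<⇒≱ ℕ.≤-refl)
  where
  misses : ∀ x → ¬ (y ≡ f x)
  misses x y≡fx = ¬p (x , sym y≡fx)
  punched-inj : Injective _≡_ _≡_ (λ x → punchOut (misses x))
  punched-inj eq = inj (Fin.punchOut-injective (misses _) (misses _) eq)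

-- From zero-sum matrices to magic rectangles.

diagonal : ∀ {c} → Fin c → Fin c → ℕ → Maybe ℕ
diagonal t t' x with t Fin.≟ t'
... | yes _ = just x
... | no  _ = nothing

diagonal-self : ∀ {c} (t : Fin c) x → diagonal t t x ≡ just x
diagonal-self t x with t Fin.≟ t
... | yes _ = refl
... | no ¬p = contradiction refl ¬p

diagonal-just : ∀ {c} (t t' : Fin c) x {y} → diagonal t t' x ≡ just y → t ≡ t' × x ≡ y
diagonal-just t t' x eq with t Fin.≟ t'
diagonal-just t t' x refl | yes p = p , refl
diagonal-just t t' x ()   | no _

diagonal-suc : ∀ {c} (t t' : Fin c) x → diagonal (suc t) (suc t') x ≡ diagonal t t' x
diagonal-suc t t' x with t Fin.≟ t'
... | yes _ = refl
... | no  _ = refl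

module _ (w : Maybe ℕ → ℕ) (w-nothing : w nothing ≡ 0) where

  -- The weight `w` is arbitrary so that counts (`filled`) and sums (`value`) share one proof.
  sum-diagonalʳ : ∀ {c} (t : Fin c) x → ∑ℕ.sum (λ t' → w (diagonal t t' x)) ≡ w (just x)
  sum-diagonalʳ {suc c} zero x =
    trans (cong (_+_ (w (just x))) (trans (∑ℕ.sum-cong-≗ {c} (λ _ → w-nothing)) (∑ℕ.sum-replicate-zero c)))
          (ℕ.+-identityʳ _)
  sum-diagonalʳ {suc c} (suc t) x =
    trans (cong₂ _+_ w-nothing (∑ℕ.sum-cong-≗ (λ t' → cong w (diagonal-suc t t' x)))) (sum-diagonalʳ t x)

  sum-diagonalˡ : ∀ {c} (t' : Fin c) (f : Fin c → ℕ) →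
                  ∑ℕ.sum (λ t → w (diagonal t t' (f t))) ≡ w (just (f t'))
  sum-diagonalˡ {suc c} zero f =
    trans (cong (_+_ (w (just (f zero)))) (trans (∑ℕ.sum-cong-≗ {c} (λ _ → w-nothing)) (∑ℕ.sum-replicate-zero c)))
          (ℕ.+-identityʳ _)
  sum-diagonalˡ {suc c} (suc t') f =
    trans (cong₂ _+_ w-nothing (∑ℕ.sum-cong-≗ (λ t → cong w (diagonal-suc t t' (f (suc t))))))
          (sum-diagonalˡ t' (f ∘ suc))

-- T indexes the blocks on the diagonal; entries are those of a magic rectangle up to an affine map.
record ZeroSum (T : Set) (a b : ℕ) : Set where
  field
    entry    : Fin a → Fin b → T → ℤ
    row-zero : ∀ i t → ∑ (λ j → entry i j t) ≡ 0ℤ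
    col-zero : ∀ j t → ∑ (λ i → entry i j t) ≡ 0ℤ

open ZeroSum

_hits_ : ∀ {T a b} → ZeroSum T a b → ℤ → Set
M hits v = ∃ λ i → ∃ λ j → ∃ λ t → entry M i j t ≡ v

-- By counting, N cells that hit N different values s x + r hit each of them once and nothing else.
module FromZeroSum {a b c} (M : ZeroSum (Fin c) a b) (s : ℕ) .{{_ : NonZero s}} (r : ℤ)
  (hit : ∀ x → x < a * c * b → M hits (+ s *ᶻ + x +ᶻ r)) where

  N : ℕ
  N = a * c * b

  affine-injective : ∀ {x y} → + s *ᶻ + x +ᶻ r ≡ + s *ᶻ + y +ᶻ r → x ≡ y
  affine-injective {x} {y} eq =
    ℤ.+-injective (ℤ.*-cancelˡ-≡ (+ s) (+ x) (+ y) {{ +s-nonZero s }} (ℤ-group.∙-cancelʳ r _ _ eq))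
    where
    +s-nonZero : ∀ s → .{{_ : NonZero s}} → ℤ.NonZero (+ s)
    +s-nonZero (suc _) = _

  row : Fin (a * c) → Fin a
  row = quotient c

  block : Fin (a * c) → Fin c
  block = remainder {a} c

  cell : Fin N → Fin N
  cell x = let (i , j , t , _) = hit (toℕ x) (Fin.toℕ<n x) in combine (combine {a} i t) j

  number : Fin (a * c) → Fin b → ℤ
  number I j = entry M (row I) j (block I)

  numberᴺ : Fin N → ℤ
  numberᴺ k = number (quotient b k) (remainder {a * c} b k)

  number-combine : ∀ i t j → number (combine {a} i t) j ≡ entry M i j t
  number-combine i t j = cong₂ (λ i t → entry M i j t)
    (cong proj₁ (Fin.remQuot-combine i t)) (cong proj₂ (Fin.remQuot-combine {a} i t))

  numberᴺ-combine : ∀ i t j → numberᴺ (combine (combine {a} i t) j) ≡ entry M i j t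
  numberᴺ-combine i t j =
    trans (cong₂ number (cong proj₁ (Fin.remQuot-combine (combine {a} i t) j))
                        (cong proj₂ (Fin.remQuot-combine (combine {a} i t) j)))
          (number-combine i t j)

  number-cell : ∀ x → numberᴺ (cell x) ≡ + s *ᶻ + toℕ x +ᶻ r
  number-cell x = let (i , j , t , eq) = hit (toℕ x) (Fin.toℕ<n x) in trans (numberᴺ-combine i t j) eq

  cell-injective : Injective _≡_ _≡_ cell
  cell-injective {x} {y} eq = Fin.toℕ-injective
    (affine-injective (trans (sym (number-cell x)) (trans (cong numberᴺ eq) (number-cell y))))

  -- Inverse of `cell`, which is a bijection as an injective self-map of `Fin N`. It gives each cell
  -- exactly one number, although `hit` only promises some cell for each number.
  index : Fin N → Fin N
  index k = proj₁ (injective⇒surjective cell-injective k)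

  cell-index : ∀ k → cell (index k) ≡ k
  cell-index k = proj₂ (injective⇒surjective cell-injective k)

  index-injective : ∀ {k l} → toℕ (index k) ≡ toℕ (index l) → k ≡ l
  index-injective {k} {l} eq =
    trans (sym (cell-index k)) (trans (cong cell (Fin.toℕ-injective eq)) (cell-index l))

  F : Fin (a * c) → Fin b → ℕ
  F I j = toℕ (index (combine I j))

  number-F : ∀ I j → number I j ≡ + s *ᶻ + F I j +ᶻ r
  number-F I j = trans
    (sym (cong₂ number (cong proj₁ (Fin.remQuot-combine I j)) (cong proj₂ (Fin.remQuot-combine I j))))
    (trans (cong numberᴺ (sym (cell-index (combine I j)))) (number-cell (index (combine I j))))

  -- Summing the affine relation along the line gives s ∑ x + n r = 0, so ∑ x depends only on the
  -- length of the line. The absolute value and the division write this constant as a natural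
  -- number.
  line-sum : ∀ n (f : Fin n → ℤ) (x : Fin n → ℕ) → ∑ f ≡ 0ℤ → (∀ i → f i ≡ + s *ᶻ + x i +ᶻ r) →
             ∑ℕ.sum x ≡ ∣ + n *ᶻ r ∣ / s
  line-sum n f x f-zero f-affine = sym (trans (cong (_/ s) (trans abs-eq (ℕ.*-comm s (∑ℕ.sum x))))
                                              (m*n/n≡m (∑ℕ.sum x) s))
    where
    open ≡-Reasoning
    balance : + s *ᶻ + ∑ℕ.sum x +ᶻ + n *ᶻ r ≡ 0ℤ
    balance = begin
      + s *ᶻ + ∑ℕ.sum x +ᶻ + n *ᶻ r
        ≡⟨ cong₂ _+ᶻ_ (trans (cong (+ s *ᶻ_) (+-sum x)) (∑ℤ.*-distribˡ-sum (+ s) (λ i → + x i)))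
                      (sym (sum-const n r)) ⟩
      ∑ (λ i → + s *ᶻ + x i) +ᶻ ∑ {n} (λ _ → r)
        ≡⟨ ∑ℤ.∑-distrib-+ (λ i → + s *ᶻ + x i) (λ _ → r) ⟨
      ∑ (λ i → + s *ᶻ + x i +ᶻ r)
        ≡⟨ ∑ℤ.sum-cong-≗ f-affine ⟨
      ∑ f
        ≡⟨ f-zero ⟩
      0ℤ ∎
    abs-eq : ∣ + n *ᶻ r ∣ ≡ s * ∑ℕ.sum x
    abs-eq = begin
      ∣ + n *ᶻ r ∣            ≡⟨ ℤ.∣-i∣≡∣i∣ (+ n *ᶻ r) ⟨
      ∣ -ᶻ (+ n *ᶻ r) ∣       ≡⟨ cong ∣_∣ (sym (ℤ-group.inverseˡ-unique (+ s *ᶻ + ∑ℕ.sum x) (+ n *ᶻ r) balance)) ⟩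
      ∣ + s *ᶻ + ∑ℕ.sum x ∣   ≡⟨ ℤ.abs-* (+ s) (+ ∑ℕ.sum x) ⟩
      s * ∑ℕ.sum x            ∎

  -- With row indices (i, t) and column indices (j, t'), each cell (i, j) becomes a c × c diagonal
  -- matrix. Sorting rows and columns by t first would show the c blocks along the diagonal.
  A : Array (a * c) (b * c)
  A I J = diagonal (block I) (remainder {b} c J) (F I (quotient c J))

  A-combine : ∀ I j t → A I (combine {b} j t) ≡ diagonal (block I) t (F I j)
  A-combine I j t = cong₂ (λ t j → diagonal (block I) t (F I j))
    (cong proj₂ (Fin.remQuot-combine j t)) (cong proj₁ (Fin.remQuot-combine {b} j t))

  module _ (w : Maybe ℕ → ℕ) (w-nothing : w nothing ≡ 0) where
    open ≡-Reasoning

    row-total : ∀ I → Σ-fin (b * c) (λ J → w (A I J)) ≡ ∑ℕ.sum (λ j → w (just (F I j)))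
    row-total I = begin
      Σ-fin (b * c) (λ J → w (A I J))
        ≡⟨ Σ-fin≡sum (b * c) _ ⟩
      ∑ℕ.sum (λ J → w (A I J))
        ≡⟨ sum-combine ℕ.+-*-semiring b (λ J → w (A I J)) ⟩
      ∑ℕ.sum (λ j → ∑ℕ.sum (λ t → w (A I (combine {b} j t))))
        ≡⟨ ∑ℕ.sum-cong-≗ (λ j → trans (∑ℕ.sum-cong-≗ (λ t → cong w (A-combine I j t)))
                                       (sum-diagonalʳ w w-nothing (block I) (F I j))) ⟩
      ∑ℕ.sum (λ j → w (just (F I j))) ∎

    col-total : ∀ J → Σ-fin (a * c) (λ I → w (A I J)) ≡
                ∑ℕ.sum (λ i → w (just (F (combine {a} i (remainder {b} c J)) (quotient c J))))
    col-total J = begin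
      Σ-fin (a * c) (λ I → w (A I J))
        ≡⟨ Σ-fin≡sum (a * c) _ ⟩
      ∑ℕ.sum (λ I → w (A I J))
        ≡⟨ sum-combine ℕ.+-*-semiring a (λ I → w (A I J)) ⟩
      ∑ℕ.sum (λ i → ∑ℕ.sum (λ t → w (A (combine {a} i t) J)))
        ≡⟨ ∑ℕ.sum-cong-≗ (λ i → trans (∑ℕ.sum-cong-≗ (λ t → cong w (block-combine i t)))
             (sum-diagonalˡ w w-nothing (remainder {b} c J) (λ t → F (combine {a} i t) (quotient c J)))) ⟩
      ∑ℕ.sum (λ i → w (just (F (combine {a} i (remainder {b} c J)) (quotient c J)))) ∎
      where
      block-combine : ∀ i t → A (combine {a} i t) J ≡
                      diagonal t (remainder {b} c J) (F (combine {a} i t) (quotient c J))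
      block-combine i t = cong (λ t' → diagonal t' (remainder {b} c J) (F (combine {a} i t) (quotient c J)))
        (cong proj₂ (Fin.remQuot-combine i t))

  magicRectangle : MR (a * c) (b * c) b a
  magicRectangle = A , record
    { rowFilled = λ I → trans (row-total filled refl I) (sumℕ-ones b)
    ; colFilled = λ J → trans (col-total filled refl J) (sumℕ-ones a)
    ; inRange   = λ I J x eq → subst (_< N) (proj₂ (diagonal-just _ _ _ eq))
                    (Fin.toℕ<n (index (combine I (quotient c J))))
    ; occurs    = occurs
    ; once      = once
    ; rowMagic  = ∣ + b *ᶻ r ∣ / s , λ I → trans (row-total value refl I)
                    (line-sum b _ (F I) (row-zero M (row I) (block I)) (number-F I))
    ; colMagic  = ∣ + a *ᶻ r ∣ / s , λ J → trans (col-total value refl J)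
                    (line-sum a _ _ (col-zero M (quotient c J) (remainder {b} c J))
                      (λ i → trans (sym (number-combine i _ (quotient c J))) (number-F (combine {a} i _) (quotient c J))))
    }
    where
    occurs : ∀ x → x < N → ∃₂ λ I J → A I J ≡ just x
    occurs x x<N = combine {a} i t , combine {b} j t , (begin
      A (combine {a} i t) (combine {b} j t)
        ≡⟨ A-combine (combine {a} i t) j t ⟩
      diagonal (block (combine {a} i t)) t (F (combine {a} i t) j)
        ≡⟨ cong (λ t' → diagonal t' t (F (combine {a} i t) j)) (cong proj₂ (Fin.remQuot-combine i t)) ⟩
      diagonal t t (F (combine {a} i t) j)
        ≡⟨ diagonal-self t _ ⟩
      just (F (combine {a} i t) j)
        ≡⟨ cong just (affine-injective (trans (sym (number-F (combine {a} i t) j)) (trans (number-combine i t j) eq))) ⟩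
      just x ∎)
      where
      open ≡-Reasoning
      i = proj₁ (hit x x<N)
      j = proj₁ (proj₂ (hit x x<N))
      t = proj₁ (proj₂ (proj₂ (hit x x<N)))
      eq = proj₂ (proj₂ (proj₂ (hit x x<N)))

    once : ∀ I J I' J' x → A I J ≡ just x → A I' J' ≡ just x → I ≡ I' × J ≡ J'
    once I J I' J' x eq eq' = I≡I' , J≡J'
      where
      open ≡-Reasoning
      same-cell : combine I (quotient c J) ≡ combine I' (quotient c J')
      same-cell = index-injective (trans (proj₂ (diagonal-just _ _ _ eq)) (sym (proj₂ (diagonal-just _ _ _ eq'))))
      I≡I' = Fin.combine-injectiveˡ I (quotient c J) I' (quotient c J') same-cell
      J≡J' : J ≡ J'
      J≡J' = begin
        J                                             ≡⟨ Fin.combine-remQuot {b} c J ⟨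
        combine {b} (quotient {b} c J) (remainder {b} c J)
          -- In a filled cell the column has the same block number as the row, so equal rows force
          -- equal remainders.
          ≡⟨ cong₂ (combine {b}) (Fin.combine-injectiveʳ I (quotient c J) I' (quotient c J') same-cell)
               (trans (sym (proj₁ (diagonal-just _ _ _ eq)))
                 (trans (cong block I≡I') (proj₁ (diagonal-just _ _ _ eq')))) ⟩
        combine {b} (quotient {b} c J') (remainder {b} c J')  ≡⟨ Fin.combine-remQuot {b} c J' ⟩
        J'                                            ∎

-- Blocks and strips

++-all : ∀ {A : Set} {m n} (Q : A → Set) {xs : Vector A m} {ys : Vector A n} →
         (∀ i → Q (xs i)) → (∀ j → Q (ys j)) → ∀ k → Q ((xs ++ ys) k)
++-all {m = m} Q qx qy k with splitAt m k
... | inj₁ i = qx i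
... | inj₂ j = qy j

∑-++ : ∀ {A : Set} {m n} (f : A → ℤ) (xs : Vector A m) (ys : Vector A n) →
       ∑ (λ k → f ((xs ++ ys) k)) ≡ ∑ (f ∘ xs) +ᶻ ∑ (f ∘ ys)
∑-++ {m = m} f xs ys = trans (sum-split ℤ.+-*-semiring m _)
  (cong₂ _+ᶻ_ (∑ℤ.sum-cong-≗ (λ i → cong f (lookup-++ˡ xs ys i)))
              (∑ℤ.sum-cong-≗ (λ j → cong f (lookup-++ʳ xs ys j))))

∑-neg : ∀ {n} (f : Fin n → ℤ) → ∑ (λ i → -ᶻ f i) ≡ -ᶻ ∑ f
∑-neg {zero}  f = refl
∑-neg {suc n} f = trans (cong (_+ᶻ_ (-ᶻ f zero)) (∑-neg (f ∘ suc))) (sym (ℤ.neg-distrib-+ (f zero) (∑ (f ∘ suc))))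

-- `P` speaks of absolute values, so the prescribed set of entries is symmetric: `v` and `-v` are
-- hit together.
record Block (T : Set) (a b : ℕ) (P : ℕ → Set) : Set where
  field
    matrix : ZeroSum T a b
    covers : ∀ v → P ∣ v ∣ → matrix hits v
open Block

transposeᶻ : ∀ {T a b} → ZeroSum T a b → ZeroSum T b a
transposeᶻ M = record
  { entry = λ j i → entry M i j ; row-zero = col-zero M ; col-zero = row-zero M }

transpose : ∀ {T a b P} → Block T a b P → Block T b a P
transpose B = record
  { matrix = transposeᶻ (matrix B)
  ; covers = λ v p → let (i , j , t , eq) = covers B v p in j , i , t , eq
  }

above : ∀ {T a a' b P Q} → Block T a b P → Block T a' b Q → Block T (a + a') b (λ n → P n ⊎ Q n)
above {T} {a} {a'} {b} {P} {Q} B B' = record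
  { matrix = record
    { entry    = entries
    ; row-zero = ++-all (λ row → ∀ t → ∑ (λ j → row j t) ≡ 0ℤ) {entry M} (row-zero M) (row-zero M')
    ; col-zero = λ j t → trans (∑-++ (λ row → row j t) (entry M) (entry M'))
                               (cong₂ _+ᶻ_ (col-zero M j t) (col-zero M' j t))
    }
  ; covers = λ v → [ top v , bottom v ]′
  }
  where
  M  = matrix B
  M' = matrix B'
  entries : Fin (a + a') → Fin b → T → ℤ
  entries = entry M ++ entry M'
  Hits : ℤ → Set
  Hits v = ∃ λ i → ∃ λ j → ∃ λ t → entries i j t ≡ v
  top : ∀ v → P ∣ v ∣ → Hits v
  top v p = let (i , j , t , eq) = covers B v p in
    i ↑ˡ a' , j , t , trans (cong (λ row → row j t) (lookup-++ˡ (entry M) (entry M') i)) eq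
  bottom : ∀ v → Q ∣ v ∣ → Hits v
  bottom v q = let (i , j , t , eq) = covers B' v q in
    a ↑ʳ i , j , t , trans (cong (λ row → row j t) (lookup-++ʳ (entry M) (entry M') i)) eq

beside : ∀ {T a b b' P Q} → Block T a b P → Block T a b' Q → Block T a (b + b') (λ n → P n ⊎ Q n)
beside B B' = transpose (above (transpose B) (transpose B'))

weaken : ∀ {T a b P Q} → (∀ n → Q n → P n) → Block T a b P → Block T a b Q
weaken Q⇒P B = record { matrix = matrix B ; covers = λ v q → covers B v (Q⇒P _ q) }

pile : ∀ m {T a b} {P : Fin m → ℕ → Set} → (∀ s → Block T a b (P s)) →
       Block T (m * a) b (λ n → ∃ λ s → P s n)
pile zero B = record
  { matrix = record { entry = λ () ; row-zero = λ () ; col-zero = λ _ _ → refl }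
  ; covers = λ { v (() , _) } }
pile (suc m) B = weaken
  (λ { n (zero , p) → inj₁ p ; n (suc s , p) → inj₂ (s , p) })
  (above (B zero) (pile m (B ∘ suc)))

line : ∀ m {T a b} {P : Fin m → ℕ → Set} → (∀ s → Block T a b (P s)) →
       Block T a (m * b) (λ n → ∃ λ s → P s n)
line m B = transpose (pile m (transpose ∘ B))

-- A piece of a row. Values are reached only up to sign because `mirror` adds the opposite row; a
-- nonzero total `σ` has to be compensated by another piece before that.
record Strip (T : Set) (b : ℕ) (σ : ℤ) (P : ℕ → Set) : Set where
  field
    item   : Fin b → T → ℤ
    total  : ∀ t → ∑ (λ j → item j t) ≡ σ
    reach  : ∀ n → P n → ∃ λ j → ∃ λ t → ∣ item j t ∣ ≡ n
open Strip

join : ∀ {T b b' σ τ P Q} → Strip T b σ P → Strip T b' τ Q → Strip T (b + b') (σ +ᶻ τ) (λ n → P n ⊎ Q n)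
join {b = b} {b'} S S' = record
  { item  = item S ++ item S'
  ; total = λ t → trans (∑-++ (λ x → x t) (item S) (item S')) (cong₂ _+ᶻ_ (total S t) (total S' t))
  ; reach = λ
    { n (inj₁ p) → let (j , t , eq) = reach S n p in
        j ↑ˡ b' , t , trans (cong (λ x → ∣ x t ∣) (lookup-++ˡ (item S) (item S') j)) eq
    ; n (inj₂ q) → let (j , t , eq) = reach S' n q in
        b ↑ʳ j , t , trans (cong (λ x → ∣ x t ∣) (lookup-++ʳ (item S) (item S') j)) eq }
  }

weakenˢ : ∀ {T b σ P Q} → (∀ n → Q n → P n) → Strip T b σ P → Strip T b σ Q
weakenˢ Q⇒P S = record { item = item S ; total = total S ; reach = λ n q → reach S n (Q⇒P n q) }

chain : ∀ m {T b} {P : Fin m → ℕ → Set} → (∀ s → Strip T b 0ℤ (P s)) →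
        Strip T (m * b) 0ℤ (λ n → ∃ λ s → P s n)
chain zero    S = record { item = λ () ; total = λ _ → refl ; reach = λ { n (() , _) } }
chain (suc m) S = weakenˢ
  (λ { n (zero , p) → inj₁ p ; n (suc s , p) → inj₂ (s , p) })
  (join (S zero) (chain m (S ∘ suc)))

∣i∣≡∣j∣⇒i≡±j : ∀ i j → ∣ i ∣ ≡ ∣ j ∣ → i ≡ j ⊎ i ≡ -ᶻ j
∣i∣≡∣j∣⇒i≡±j (+ m)       (+ n)       refl = inj₁ refl
∣i∣≡∣j∣⇒i≡±j (+ suc m)   -[1+ n ]    refl = inj₂ refl
∣i∣≡∣j∣⇒i≡±j -[1+ m ]    (+ suc n)   refl = inj₂ refl
∣i∣≡∣j∣⇒i≡±j -[1+ m ]    -[1+ n ]    refl = inj₁ refl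

-- Each column is x, -x, and whichever sign of a reached value is missing in the first row stands in
-- the second.
mirror : ∀ {T b P} → Strip T b 0ℤ P → Block T 2 b P
mirror {T} {b} {P} S = record
  { matrix = record
    { entry    = rows
    ; row-zero = λ { 0F t → total S t
                   ; 1F t → trans (∑-neg (λ j → item S j t)) (cong -ᶻ_ (total S t)) }
    ; col-zero = λ j t → cancel (item S j t)
    }
  ; covers = covered
  }
  where
  rows : Fin 2 → Fin b → T → ℤ
  rows 0F j t = item S j t
  rows 1F j t = -ᶻ item S j t
  cancel : ∀ x → x +ᶻ (-ᶻ x +ᶻ 0ℤ) ≡ 0ℤ
  cancel = solve-∀
  covered : ∀ v → P ∣ v ∣ → ∃ λ i → ∃ λ j → ∃ λ t → rows i j t ≡ v
  covered v p with reach S ∣ v ∣ p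
  ... | j , t , eq with ∣i∣≡∣j∣⇒i≡±j (item S j t) v eq
  ...   | inj₁ i≡v  = 0F , j , t , i≡v
  ...   | inj₂ i≡-v = 1F , j , t , trans (cong -ᶻ_ i≡-v) (ℤ.neg-involutive v)

strip : ∀ {T b σ} (item : Fin b → T → ℤ) → (∀ t → ∑ (λ j → item j t) ≡ σ) →
        Strip T b σ (λ n → ∃ λ j → ∃ λ t → ∣ item j t ∣ ≡ n)
strip item total = record { item = item ; total = total ; reach = λ n p → p }

divide : ∀ n k {m} → m < n * k → ∃ λ (q : Fin n) → ∃ λ (r : Fin k) → m ≡ k * toℕ q + toℕ r
divide n k {m} m<nk with remQuot {n} k (fromℕ< m<nk) in eq
... | q , r = q , r , trans (sym (Fin.toℕ-fromℕ< m<nk)) (trans (cong toℕ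
  (trans (sym (Fin.combine-remQuot {n} k _)) (cong (λ { (q , r) → combine q r }) eq))) (Fin.toℕ-combine q r))

-- Groups of four with signs + - - +.

SecondDifferenceZero : (ℕ → ℕ) → Set
SecondDifferenceZero val = ∀ m →
  + val m +ᶻ (-ᶻ + val (1 + m) +ᶻ (-ᶻ + val (2 + m) +ᶻ (+ val (3 + m) +ᶻ 0ℤ))) ≡ 0ℤ

module _ {T : Set} (val : ℕ → ℕ) (affine : SecondDifferenceZero val) where

  quad : (x : T → ℕ) → Strip T 4 0ℤ (λ n → ∃ λ t → ∃ λ (k : Fin 4) → n ≡ val (toℕ k + x t))
  quad x = weakenˢ
    (λ { n (t , 0F , refl) → 0F , t , refl
       ; n (t , 1F , refl) → 1F , t , ℤ.∣-i∣≡∣i∣ (+ val (1 + x t))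
       ; n (t , 2F , refl) → 2F , t , ℤ.∣-i∣≡∣i∣ (+ val (2 + x t))
       ; n (t , 3F , refl) → 3F , t , refl })
    (strip items (λ t → affine (x t)))
    where
    items : Fin 4 → T → ℤ
    items 0F t = + val (x t)
    items 1F t = -ᶻ + val (1 + x t)
    items 2F t = -ᶻ + val (2 + x t)
    items 3F t = + val (3 + x t)

  quads : ∀ w (x : Fin w → T → ℕ) →
          Strip T (w * 4) 0ℤ (λ n → ∃ λ r → ∃ λ t → ∃ λ (k : Fin 4) → n ≡ val (toℕ k + x r t))
  quads w x = chain w (λ r → quad (x r))

-- For an even number of cells the mean is half-integral; doubled deviations from it are odd.
odd : ℕ → ℕ
odd m = suc (m + m)

odd-affine : SecondDifferenceZero odd
odd-affine m = lemma (+ m)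
  where
  lemma : ∀ x → + 1 +ᶻ (x +ᶻ x) +ᶻ
            (-ᶻ (+ 1 +ᶻ ((+ 1 +ᶻ x) +ᶻ (+ 1 +ᶻ x))) +ᶻ
            (-ᶻ (+ 1 +ᶻ ((+ 2 +ᶻ x) +ᶻ (+ 2 +ᶻ x))) +ᶻ
            ((+ 1 +ᶻ ((+ 3 +ᶻ x) +ᶻ (+ 3 +ᶻ x))) +ᶻ 0ℤ))) ≡ 0ℤ
  lemma = solve-∀

id-affine : SecondDifferenceZero id
id-affine m = lemma (+ m)
  where
  lemma : ∀ x → x +ᶻ (-ᶻ (+ 1 +ᶻ x) +ᶻ (-ᶻ (+ 2 +ᶻ x) +ᶻ ((+ 3 +ᶻ x) +ᶻ 0ℤ))) ≡ 0ℤ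
  lemma = solve-∀

-- Even side lengths

module EvenCase (p c : ℕ) where

  C : ℕ
  C = p * c

  -- Enumerates the pairs of a strip and a block; each pair receives its own `w` consecutive groups
  -- of four.
  strip-number : Fin p → Fin c → ℕ
  strip-number i t = c * toℕ i + toℕ t

  strip-number<C : ∀ i t → strip-number i t < C
  strip-number<C i t = subst (_< C) (Fin.toℕ-combine i t) (Fin.toℕ<n (combine i t))

  QuadNumber : ℕ → (w : ℕ) → Fin p → ℕ → Set
  QuadNumber base w i n = ∃ λ (r : Fin w) → ∃ λ (t : Fin c) → ∃ λ (k : Fin 4) →
    n ≡ odd (toℕ k + (base + 4 * (w * strip-number i t + toℕ r)))

  quads-from : ∀ base w i → Strip (Fin c) (w * 4) 0ℤ (QuadNumber base w i)
  quads-from base w i = quads odd odd-affine w (λ r t → base + 4 * (w * strip-number i t + toℕ r))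

  -- Mixed-radix digits of `m`, from the lowest: the place `k` in a group of four, the group `r`,
  -- the block `t` and the strip `i`.
  locate-quad : ∀ base w m → m < C * w * 4 → ∃ λ i → QuadNumber base w i (odd (base + m))
  locate-quad base w m m< =
    let (x , k , eq)  = divide (C * w) 4 m<
        (u , r , eq₁) = divide C w (Fin.toℕ<n x)
        (i , t , eq₂) = divide p c (Fin.toℕ<n u)
    in i , r , t , k , cong odd (begin
      base + m                       ≡⟨ cong (_+_ base) eq ⟩
      base + (4 * toℕ x + toℕ k)     ≡⟨ ℕ.+-assoc base _ _ ⟨
      base + 4 * toℕ x + toℕ k       ≡⟨ ℕ.+-comm _ (toℕ k) ⟩
      toℕ k + (base + 4 * toℕ x)
        ≡⟨ cong (λ y → toℕ k + (base + 4 * y)) (trans eq₁ (cong (λ y → w * y + toℕ r) eq₂)) ⟩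
      toℕ k + (base + 4 * (w * strip-number i t + toℕ r)) ∎)
    where open ≡-Reasoning

  fours : ∀ w → Block (Fin c) (p * 2) (w * 4) (λ n → ∃ λ m → m < C * w * 4 × n ≡ odd m)
  fours w = weaken (λ { n (m , m< , refl) → locate-quad 0 w m m< }) (pile p (λ i → mirror (quads-from 0 w i)))

  offset : Fin 6 → ℕ → ℕ
  offset 1F u = C ∸ suc u
  offset _  u = u

  SextupleNumber : Fin p → ℕ → Set
  SextupleNumber i n = ∃ λ (k : Fin 6) → ∃ λ t → n ≡ odd (toℕ k * C + offset k (strip-number i t))

  -- One value from each of six intervals of length C with signs + + + - + -; the offset u
  -- cancels because the second interval contributes at its complement C - 1 - u.
  sextuple : ∀ i → Strip (Fin c) 6 0ℤ (SextupleNumber i)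
  sextuple i = weakenˢ
    (λ { n (0F , t , refl) → 0F , t , refl
       ; n (1F , t , refl) → 1F , t , refl
       ; n (2F , t , refl) → 2F , t , refl
       ; n (3F , t , refl) → 3F , t , ℤ.∣-i∣≡∣i∣ (+ odd (3 * C + strip-number i t))
       ; n (4F , t , refl) → 4F , t , refl
       ; n (5F , t , refl) → 5F , t , ℤ.∣-i∣≡∣i∣ (+ odd (5 * C + strip-number i t)) })
    (strip items (λ t → balanced (strip-number i t) (C ∸ suc (strip-number i t)) C
                          (sym (ℕ.m+[n∸m]≡n (strip-number<C i t)))))
    where
    items : Fin 6 → Fin c → ℤ
    items k t with + odd (toℕ k * C + offset k (strip-number i t))
    items 3F t | v = -ᶻ v
    items 5F t | v = -ᶻ v
    items _  t | v = v
    collect : ∀ u u' z →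
      (+ 1 +ᶻ ((0ℤ +ᶻ u) +ᶻ (0ℤ +ᶻ u)))
        +ᶻ ((+ 1 +ᶻ (((z +ᶻ 0ℤ) +ᶻ u') +ᶻ ((z +ᶻ 0ℤ) +ᶻ u')))
        +ᶻ ((+ 1 +ᶻ (((z +ᶻ (z +ᶻ 0ℤ)) +ᶻ u) +ᶻ ((z +ᶻ (z +ᶻ 0ℤ)) +ᶻ u)))
        +ᶻ (-ᶻ (+ 1 +ᶻ (((z +ᶻ (z +ᶻ (z +ᶻ 0ℤ))) +ᶻ u) +ᶻ ((z +ᶻ (z +ᶻ (z +ᶻ 0ℤ))) +ᶻ u)))
        +ᶻ ((+ 1 +ᶻ (((z +ᶻ (z +ᶻ (z +ᶻ (z +ᶻ 0ℤ)))) +ᶻ u) +ᶻ ((z +ᶻ (z +ᶻ (z +ᶻ (z +ᶻ 0ℤ)))) +ᶻ u)))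
        +ᶻ (-ᶻ (+ 1 +ᶻ (((z +ᶻ (z +ᶻ (z +ᶻ (z +ᶻ (z +ᶻ 0ℤ))))) +ᶻ u) +ᶻ ((z +ᶻ (z +ᶻ (z +ᶻ (z +ᶻ (z +ᶻ 0ℤ))))) +ᶻ u)))
        +ᶻ (0ℤ))))))
      ≡ + 2 *ᶻ ((+ 1 +ᶻ (u +ᶻ u')) +ᶻ -ᶻ z)
    collect = solve-∀
    -- In units of C the intervals give 0 + 1 + 2 - 3 + 4 - 5 = -1, and the offsets leave u + u' = C
    -- - 1, so the doubled part is -2. The surplus of two plus signs restores it, as `odd` adds 1 to
    -- each doubled number.
    balanced : ∀ u u' C → C ≡ suc u + u' →
      + odd (0 * C + u) +ᶻ (+ odd (1 * C + u') +ᶻ (+ odd (2 * C + u)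
        +ᶻ (-ᶻ (+ odd (3 * C + u)) +ᶻ (+ odd (4 * C + u) +ᶻ (-ᶻ (+ odd (5 * C + u)) +ᶻ 0ℤ))))) ≡ 0ℤ
    balanced u u' C refl = trans (collect (+ u) (+ u') (+ C)) (cong (_*ᶻ_ (+ 2)) (ℤ.+-inverseʳ (+ C)))

  locate-sextuple : ∀ m → m < 6 * C → ∃ λ i → SextupleNumber i (odd m)
  locate-sextuple m m< with divide 6 C m<
  ... | k , o , eq = let (i , t , eq') = decode k in i , k , t ,
        cong odd (trans eq (cong₂ _+_ (ℕ.*-comm C (toℕ k)) eq'))
    where
    decode : ∀ k → ∃ λ i → ∃ λ t → toℕ o ≡ offset k (strip-number i t)
    plain : ∃ λ i → ∃ λ t → toℕ o ≡ strip-number i t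
    plain = divide p c (Fin.toℕ<n o)
    decode 0F = plain
    -- The second interval is run through backwards, so the complement of `o` is the strip number.
    decode 1F = let (i , t , eq) = divide p c (Fin.toℕ<n (opposite o)) in i , t , (begin
      toℕ o                            ≡⟨ cong toℕ (Fin.opposite-involutive o) ⟨
      toℕ (opposite (opposite o))      ≡⟨ Fin.opposite-prop (opposite o) ⟩
      C ∸ suc (toℕ (opposite o))       ≡⟨ cong (λ u → C ∸ suc u) eq ⟩
      C ∸ suc (strip-number i t)       ∎)
      where open ≡-Reasoning
    decode 2F = plain
    decode 3F = plain
    decode 4F = plain
    decode 5F = plain

  sixes : ∀ w → Block (Fin c) (p * 2) (6 + w * 4) (λ n → ∃ λ m → m < 6 * C + C * w * 4 × n ≡ odd m)
  sixes w = weaken (λ { n (m , m< , refl) → locate m m< })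
    (pile p (λ i → mirror (join (sextuple i) (quads-from (6 * C) w i))))
    where
    locate : ∀ m → m < 6 * C + C * w * 4 →
             ∃ λ i → SextupleNumber i (odd m) ⊎ QuadNumber (6 * C) w i (odd m)
    locate m m< with m ℕ.<? 6 * C
    ... | yes small = let (i , q) = locate-sextuple m small in i , inj₁ q
    ... | no  large = let (i , q) = locate-quad (6 * C) w (m ∸ 6 * C) rest< in
          i , inj₂ (subst (QuadNumber (6 * C) w i ∘ odd) rejoin q)
      where
      rejoin = ℕ.m+[n∸m]≡n (ℕ.≮⇒≥ large)
      rest< = ℕ.+-cancelˡ-< (6 * C) _ _ (subst (_< 6 * C + C * w * 4) (sym rejoin) m<)

-- The map x ↦ 2 x + 1 - 2 H carries 0, ..., 2 H - 1 onto the odd numbers between -2 H and 2 H, with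
-- negative values exactly for x < H.
fromOddNumbers : ∀ {a b c} H → a * c * b ≡ H + H →
  Block (Fin c) a b (λ n → ∃ λ m → m < H × n ≡ odd m) → MR (a * c) (b * c) b a
fromOddNumbers {a} {b} {c} H N≡2H B = FromZeroSum.magicRectangle (matrix B) 2 (+ 1 -ᶻ + (H + H)) hit
  where
  upper : ∀ h m → + odd m ≡ + 2 *ᶻ (h +ᶻ + m) +ᶻ (+ 1 -ᶻ (h +ᶻ h))
  upper h m = identity h (+ m)
    where
    identity : ∀ h x → + 1 +ᶻ (x +ᶻ x) ≡ + 2 *ᶻ (h +ᶻ x) +ᶻ (+ 1 -ᶻ (h +ᶻ h))
    identity = solve-∀
  lower : ∀ x m → -ᶻ (+ odd m) ≡ + 2 *ᶻ + x +ᶻ (+ 1 -ᶻ (+ (suc x + m) +ᶻ + (suc x + m)))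
  lower x m = identity (+ x) (+ m)
    where
    identity : ∀ x m → -ᶻ (+ 1 +ᶻ (m +ᶻ m)) ≡
               + 2 *ᶻ x +ᶻ (+ 1 -ᶻ ((+ 1 +ᶻ x +ᶻ m) +ᶻ (+ 1 +ᶻ x +ᶻ m)))
    identity = solve-∀
  hit : ∀ x → x < a * c * b → matrix B hits (+ 2 *ᶻ + x +ᶻ (+ 1 -ᶻ + (H + H)))
  hit x x<N with x ℕ.<? H
  ... | yes x<H = subst (matrix B hits_)
        (trans (lower x m) (cong (λ h → + 2 *ᶻ + x +ᶻ (+ 1 -ᶻ (+ h +ᶻ + h))) eq))
        (covers B (-ᶻ (+ odd m)) (m , m<H , ℤ.∣-i∣≡∣i∣ (+ odd m)))
    where
    m = H ∸ suc x
    eq : suc x + m ≡ H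
    eq = ℕ.m+[n∸m]≡n x<H
    m<H : m < H
    m<H = subst (m <_) eq (s≤s (ℕ.m≤n+m m x))
  ... | no x≮H = subst (matrix B hits_)
        (trans (upper (+ H) m) (cong (λ y → + 2 *ᶻ + y +ᶻ (+ 1 -ᶻ + (H + H))) eq))
        (covers B (+ odd m) (m , m<H , refl))
    where
    m = x ∸ H
    eq : H + m ≡ x
    eq = ℕ.m+[n∸m]≡n (ℕ.≮⇒≥ x≮H)
    m<H : m < H
    m<H = ℕ.+-cancelˡ-< H m H (subst₂ _<_ (sym eq) N≡2H x<N)

data Parity : ℕ → Set where
  twice      : ∀ h → Parity (h + h)
  suc-twice  : ∀ h → Parity (suc (h + h))

parity : ∀ n → Parity n
parity zero = twice 0
parity (suc n) with parity n
... | twice h     = suc-twice h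
... | suc-twice h = subst Parity (cong suc (ℕ.+-suc h h)) (twice (suc h))

-- The parity of q decides whether the width 2 q is a multiple of 4 or needs a group of six; an odd
-- q is at least 3, which leaves room for it.
evenRectangle : ∀ p q c → 2 ≤ q → MR (p * 2 * c) (q * 2 * c) (q * 2) (p * 2)
evenRectangle p q c 2≤q with parity q
... | twice w = subst (λ b → MR (p * 2 * c) (b * c) b (p * 2)) (width w)
      (fromOddNumbers (p * c * w * 4) (area p c w) (EvenCase.fours p c w))
  where
  width : ∀ w → w * 4 ≡ (w + w) * 2
  width = ℕ-Solver.solve-∀
  area : ∀ p c w → p * 2 * c * (w * 4) ≡ p * c * w * 4 + p * c * w * 4
  area = ℕ-Solver.solve-∀
... | suc-twice zero = contradiction 2≤q λ { (s≤s ()) }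
... | suc-twice (suc w) = subst (λ b → MR (p * 2 * c) (b * c) b (p * 2)) (width w)
      (fromOddNumbers (6 * (p * c) + p * c * w * 4) (area p c w) (EvenCase.sixes p c w))
  where
  width : ∀ w → 6 + w * 4 ≡ suc (suc w + suc w) * 2
  width = ℕ-Solver.solve-∀
  area : ∀ p c w → p * 2 * c * (6 + w * 4) ≡
          (6 * (p * c) + p * c * w * 4) + (6 * (p * c) + p * c * w * 4)
  area = ℕ-Solver.solve-∀

-- Inflation by Kotzig matrices

half-≤ : ∀ {m n} → m + m ≤ n + n → m ≤ n
half-≤ {m} {n} le = ℕ.≮⇒≥ (λ n<m → ℕ.<⇒≱ (ℕ.+-mono-< n<m n<m) le)

half-< : ∀ {m n} → m + m < n + n → m < n
half-< {m} {n} lt = ℕ.≰⇒> (λ n≤m → ℕ.<⇒≱ lt (ℕ.+-mono-≤ n≤m n≤m))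

centred-≤ : ∀ {u M} → u < suc (M + M) → ∣ + u -ᶻ + M ∣ ≤ M
centred-≤ {u} {M} u< = subst (_≤ M) (sym (cong ∣_∣ (ℤ.m-n≡m⊖n u M))) (bound (ℕ.≤-total u M))
  where
  bound : u ≤ M ⊎ M ≤ u → ∣ u ℤ.⊖ M ∣ ≤ M
  bound (inj₁ u≤M) = subst (_≤ M) (sym (ℤ.∣⊖∣-≤ u≤M)) (ℕ.m∸n≤m M u)
  bound (inj₂ M≤u) = subst (_≤ M) (sym (trans (ℤ.∣m⊖n∣≡∣n⊖m∣ u M) (ℤ.∣⊖∣-≤ M≤u)))
    (ℕ.m≤n+o⇒m∸n≤o u M (ℕ.≤-pred u<))

-- Each value v is replaced by the c values c v + y, |y| ≤ d, which the c blocks share out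
-- along the permutations in κ.
inflate : ∀ {a b c} M d → a * b ≡ suc (M + M) → Block ⊤ a b (_≤ M) → (κ : ZeroSum (Fin c) a b) →
          (∀ i j y → y < c → ∃ λ t → entry κ i j t ≡ + y -ᶻ + d) → MR (a * c) (b * c) b a
inflate {a} {b} {c} M d size B κ exhausts = FromZeroSum.magicRectangle inflated 1 (-ᶻ (+ c *ᶻ + M +ᶻ + d)) hit
  where
  inflated-zero : ∀ {n} (f g : Fin n → ℤ) → ∑ f ≡ 0ℤ → ∑ g ≡ 0ℤ → ∑ (λ i → + c *ᶻ f i +ᶻ g i) ≡ 0ℤ
  inflated-zero f g f0 g0 = begin
    ∑ (λ i → + c *ᶻ f i +ᶻ g i)     ≡⟨ ∑ℤ.∑-distrib-+ (λ i → + c *ᶻ f i) g ⟩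
    ∑ (λ i → + c *ᶻ f i) +ᶻ ∑ g     ≡⟨ cong₂ _+ᶻ_ (sym (∑ℤ.*-distribˡ-sum (+ c) f)) g0 ⟩
    + c *ᶻ ∑ f +ᶻ 0ℤ                ≡⟨ cong (λ z → + c *ᶻ z +ᶻ 0ℤ) f0 ⟩
    + c *ᶻ 0ℤ +ᶻ 0ℤ                 ≡⟨ cong (_+ᶻ 0ℤ) (ℤ.*-zeroʳ (+ c)) ⟩
    0ℤ                              ∎
    where open ≡-Reasoning
  inflated : ZeroSum (Fin c) a b
  inflated = record
    { entry    = λ i j t → + c *ᶻ entry (matrix B) i j tt +ᶻ entry κ i j t
    ; row-zero = λ i t → inflated-zero {b} (λ j → entry (matrix B) i j tt) (λ j → entry κ i j t)
        (row-zero (matrix B) i tt) (row-zero κ i t)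
    ; col-zero = λ j t → inflated-zero {a} (λ i → entry (matrix B) i j tt) (λ i → entry κ i j t)
        (col-zero (matrix B) j tt) (col-zero κ j t)
    }
  hit : ∀ x → x < a * c * b → inflated hits (+ 1 *ᶻ + x +ᶻ -ᶻ (+ c *ᶻ + M +ᶻ + d))
  -- With x = c u + y, the base value u - M and the offset y - d combine to c (u - M) + (y - d) = x
  -- - (c M + d).
  hit x x<N with divide (a * b) c (subst (x <_) (exchange a c b) x<N)
    where
    exchange : ∀ a c b → a * c * b ≡ a * b * c
    exchange = ℕ-Solver.solve-∀
  ... | u , y , x≡ with covers B (+ toℕ u -ᶻ + M) (centred-≤ (subst (toℕ u <_) size (Fin.toℕ<n u)))
  ...   | i , j , tt , eq with exhausts i j (toℕ y) (Fin.toℕ<n y)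
  ...     | t , eq' = i , j , t , (begin
    + c *ᶻ entry (matrix B) i j tt +ᶻ entry κ i j t
      ≡⟨ cong₂ (λ v w → + c *ᶻ v +ᶻ w) eq eq' ⟩
    + c *ᶻ (+ toℕ u -ᶻ + M) +ᶻ (+ toℕ y -ᶻ + d)
      ≡⟨ regroup (+ c) (+ toℕ u) (+ M) (+ toℕ y) (+ d) ⟩
    + 1 *ᶻ (+ c *ᶻ + toℕ u +ᶻ + toℕ y) +ᶻ -ᶻ (+ c *ᶻ + M +ᶻ + d)
      ≡⟨ cong (λ z → + 1 *ᶻ z +ᶻ -ᶻ (+ c *ᶻ + M +ᶻ + d))
           (trans (cong (_+ᶻ + toℕ y) (sym (ℤ.pos-* c (toℕ u)))) (cong +_ (sym x≡))) ⟩
    + 1 *ᶻ + x +ᶻ -ᶻ (+ c *ᶻ + M +ᶻ + d) ∎)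
    where
    open ≡-Reasoning
    regroup : ∀ c u M y d → c *ᶻ (u -ᶻ M) +ᶻ (y -ᶻ d) ≡ + 1 *ᶻ (c *ᶻ u +ᶻ y) +ᶻ -ᶻ (c *ᶻ M +ᶻ d)
    regroup = solve-∀

-- Kotzig matrices with three rows and their extension to odd sizes.

module Kotzig (d : ℕ) where

  c : ℕ
  c = suc (d + d)

  Exhausts : (Fin c → ℤ) → Set
  Exhausts f = ∀ y → y < c → ∃ λ t → f t ≡ + y -ᶻ + d

  -- The representative of t modulo c in [-d, d], for t < c.
  rotation : ℕ → ℤ
  rotation t with t ℕ.≤? d
  ... | yes _ = + t
  ... | no  _ = + t -ᶻ + c

  rotation-≤ : ∀ {t} → t ≤ d → rotation t ≡ + t
  rotation-≤ {t} t≤d with t ℕ.≤? d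
  ... | yes _   = refl
  ... | no  t≰d = contradiction t≤d t≰d

  rotation-> : ∀ {t} → d < t → rotation t ≡ + t -ᶻ + c
  rotation-> {t} d<t with t ℕ.≤? d
  ... | yes t≤d = contradiction d<t (ℕ.≤⇒≯ t≤d)
  ... | no  _   = refl

  shift : ℕ → ℤ
  shift t = + t -ᶻ + d

  -- The third row is forced by the zero sums. It is again a permutation of [-d, d], since it falls
  -- in steps of two: d, d - 2, ..., -d for t ≤ d, and then d - 1, ..., 1 - d.
  K : Fin 3 → Fin c → ℤ
  K 0F t = shift (toℕ t)
  K 1F t = rotation (toℕ t)
  K 2F t = -ᶻ (shift (toℕ t) +ᶻ rotation (toℕ t))

  K-sum : ∀ t → K 0F t +ᶻ K 1F t +ᶻ K 2F t ≡ 0ℤ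
  K-sum t = ℤ.+-inverseʳ (K 0F t +ᶻ K 1F t)

  at : ∀ {t} (f : ℕ → ℤ) {v} → t < c → f t ≡ v → ∃ λ (i : Fin c) → f (toℕ i) ≡ v
  at f t<c eq = fromℕ< t<c , trans (cong f (Fin.toℕ-fromℕ< t<c)) eq

  K-exhausts : ∀ r → Exhausts (K r)
  K-exhausts 0F y y<c = at shift y<c refl
  K-exhausts 1F y y<c with d ℕ.≤? y
  ... | yes d≤y = at rotation (ℕ.≤-<-trans (ℕ.m∸n≤m y d) y<c) (begin
          rotation (y ∸ d)           ≡⟨ rotation-≤ (ℕ.m≤n+o⇒m∸n≤o y d (ℕ.≤-pred y<c)) ⟩
          + (y ∸ d)                  ≡⟨ ℤ.⊖-≥ d≤y ⟨
          y ℤ.⊖ d                    ≡⟨ ℤ.m-n≡m⊖n y d ⟨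
          + y -ᶻ + d                 ∎)
    where open ≡-Reasoning
  ... | no d≰y = at rotation (s≤s (ℕ.+-monoˡ-≤ d (ℕ.≰⇒> d≰y)))
        (trans (rotation-> (s≤s (ℕ.m≤n+m d y))) (wrap (+ y) (+ d)))
    where
    wrap : ∀ y d → (+ 1 +ᶻ (y +ᶻ d)) -ᶻ (+ 1 +ᶻ (d +ᶻ d)) ≡ y -ᶻ d
    wrap = solve-∀
  -- The value y - d occurs at t = d - s if y = 2 s, and at t = 2 d - s, written `d + suc u`, if y =
  -- 2 s + 1.
  K-exhausts 2F y y<c with parity y
  ... | twice s = at {d ∸ s} (λ t → -ᶻ (shift t +ᶻ rotation t)) (s≤s (ℕ.≤-trans (ℕ.m∸n≤m d s) (ℕ.m≤m+n d d)))
        (trans (cong (λ z → -ᶻ (shift (d ∸ s) +ᶻ z)) (rotation-≤ (ℕ.m∸n≤m d s)))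
               (descend d (d ∸ s) (sym (ℕ.m∸n+n≡m (half-≤ {s} {d} (ℕ.≤-pred y<c))))))
    where
    identity : ∀ t s → -ᶻ (t -ᶻ (t +ᶻ s) +ᶻ t) ≡ s +ᶻ s -ᶻ (t +ᶻ s)
    identity = solve-∀
    descend : ∀ d t → d ≡ t + s → -ᶻ (+ t -ᶻ + d +ᶻ + t) ≡ + (s + s) -ᶻ + d
    descend _ t refl = identity (+ t) (+ s)
  ... | suc-twice s = at {d + suc u} (λ t → -ᶻ (shift t +ᶻ rotation t)) (s≤s (ℕ.+-monoʳ-≤ d 1+u≤d))
        (trans (cong (λ z → -ᶻ (shift (d + suc u) +ᶻ z))
                 (rotation-> (ℕ.m<m+n d (s≤s z≤n))))
               (descend d (sym (ℕ.m+[n∸m]≡n s<d))))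
    where
    s<d : s < d
    s<d = half-< {s} {d} (ℕ.≤-pred y<c)
    u = d ∸ suc s
    1+u≤d : suc u ≤ d
    1+u≤d = subst (suc u ≤_) (ℕ.m+[n∸m]≡n s<d) (s≤s (ℕ.m≤n+m u s))
    identity : ∀ s u →
      -ᶻ (((+ 1 +ᶻ s) +ᶻ u) +ᶻ (+ 1 +ᶻ u) -ᶻ ((+ 1 +ᶻ s) +ᶻ u)
        +ᶻ (((+ 1 +ᶻ s) +ᶻ u) +ᶻ (+ 1 +ᶻ u) -ᶻ (+ 1 +ᶻ (((+ 1 +ᶻ s) +ᶻ u) +ᶻ ((+ 1 +ᶻ s) +ᶻ u)))))
      ≡ + 1 +ᶻ (s +ᶻ s) -ᶻ ((+ 1 +ᶻ s) +ᶻ u)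
    identity = solve-∀
    descend : ∀ d → d ≡ suc s + u →
      -ᶻ (+ (d + suc u) -ᶻ + d +ᶻ (+ (d + suc u) -ᶻ + suc (d + d))) ≡ + suc (s + s) -ᶻ + d
    descend _ refl = identity (+ s) (+ u)

  data Sign : Set where
    plus minus : Sign

  apply : Sign → ℤ → ℤ
  apply plus  x = x
  apply minus x = -ᶻ x

  apply-comm : ∀ s s' x → apply s (apply s' x) ≡ apply s' (apply s x)
  apply-comm plus  s'    x = refl
  apply-comm minus plus  x = refl
  apply-comm minus minus x = refl

  apply-exhausts : ∀ s {f} → Exhausts f → Exhausts (λ t → apply s (f t))
  apply-exhausts plus  ex = ex
  apply-exhausts minus {f} ex y y<c = let (t , eq) = ex y' (s≤s (ℕ.m∸n≤m (d + d) y)) in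
    t , trans (cong -ᶻ_ eq) (trans (reflect (+ y') (+ d))
      (trans (cong (λ z → z -ᶻ + y' -ᶻ + d) 2d) (cancel (+ y) (+ y') (+ d))))
    where
    y' = d + d ∸ y
    2d : + d +ᶻ + d ≡ + y +ᶻ + y'
    2d = cong +_ (sym (ℕ.m+[n∸m]≡n (ℕ.≤-pred y<c)))
    reflect : ∀ y' d → -ᶻ (y' -ᶻ d) ≡ d +ᶻ d -ᶻ y' -ᶻ d
    reflect = solve-∀
    cancel : ∀ y y' d → y +ᶻ y' -ᶻ y' -ᶻ d ≡ y -ᶻ d
    cancel = solve-∀

  -- Addition modulo 3: a symmetric Latin square, so each of its lines meets every row of `K` once.
  latin : Fin 3 → Fin 3 → Fin 3
  latin 0F r  = r
  latin 1F 0F = 1F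
  latin 1F 1F = 2F
  latin 1F 2F = 0F
  latin 2F 0F = 2F
  latin 2F 1F = 0F
  latin 2F 2F = 1F

  latin-comm : ∀ r r' → latin r r' ≡ latin r' r
  latin-comm 0F 0F = refl
  latin-comm 0F 1F = refl
  latin-comm 0F 2F = refl
  latin-comm 1F 0F = refl
  latin-comm 1F 1F = refl
  latin-comm 1F 2F = refl
  latin-comm 2F 0F = refl
  latin-comm 2F 1F = refl
  latin-comm 2F 2F = refl

  latin-sum : ∀ (f : Fin 3 → ℤ) → f 0F +ᶻ f 1F +ᶻ f 2F ≡ 0ℤ →
              ∀ r → f (latin r 0F) +ᶻ f (latin r 1F) +ᶻ f (latin r 2F) ≡ 0ℤ
  latin-sum f eq 0F = eq
  latin-sum f eq 1F = trans (cycle (f 0F) (f 1F) (f 2F)) eq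
    where
    cycle : ∀ x y z → y +ᶻ z +ᶻ x ≡ x +ᶻ y +ᶻ z
    cycle = solve-∀
  latin-sum f eq 2F = trans (cycle (f 0F) (f 1F) (f 2F)) eq
    where
    cycle : ∀ x y z → z +ᶻ x +ᶻ y ≡ x +ᶻ y +ᶻ z
    cycle = solve-∀

  alternating : ∀ m → Fin (m * 2) → Sign
  alternating (suc m) 0F            = plus
  alternating (suc m) 1F            = minus
  alternating (suc m) (suc (suc j)) = alternating m j

  -- The first three lines carry the three Latin classes and add up to zero by `K-sum`. All further
  -- lines have class 0 and cancel in pairs of opposite sign.
  class : ∀ m → Fin (3 + m * 2) → Fin 3 × Sign
  class m 0F                  = 0F , plus
  class m 1F                  = 1F , plus
  class m 2F                  = 2F , plus
  class m (suc (suc (suc j))) = 0F , alternating m j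

  alternating-sum : ∀ m x → ∑ (λ j → apply (alternating m j) x) ≡ 0ℤ
  alternating-sum zero    x = refl
  alternating-sum (suc m) x =
    trans (cong (λ z → x +ᶻ (-ᶻ x +ᶻ z)) (alternating-sum m x)) (cancel x)
    where
    cancel : ∀ x → x +ᶻ (-ᶻ x +ᶻ 0ℤ) ≡ 0ℤ
    cancel = solve-∀

  class-sum : ∀ m (f : Fin 3 → ℤ) → f 0F +ᶻ f 1F +ᶻ f 2F ≡ 0ℤ →
              ∑ (λ j → apply (proj₂ (class m j)) (f (proj₁ (class m j)))) ≡ 0ℤ
  class-sum m f eq = trans (cong (λ z → f 0F +ᶻ (f 1F +ᶻ (f 2F +ᶻ z))) (alternating-sum m (f 0F)))
    (trans (assoc (f 0F) (f 1F) (f 2F)) eq)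
    where
    assoc : ∀ x y z → x +ᶻ (y +ᶻ (z +ᶻ 0ℤ)) ≡ x +ᶻ y +ᶻ z
    assoc = solve-∀

  module _ (k m : ℕ) where

    κ : Fin (3 + k * 2) → Fin (3 + m * 2) → Fin c → ℤ
    κ i j t = let (r , s) = class k i ; (r' , s') = class m j in apply s (apply s' (K (latin r r') t))

    kotzigMatrix : ZeroSum (Fin c) (3 + k * 2) (3 + m * 2)
    kotzigMatrix = record
      { entry    = κ
      ; row-zero = λ i t → let (r , s) = class k i in
          trans (∑ℤ.sum-cong-≗ (λ j → apply-comm s (proj₂ (class m j)) (K (latin r (proj₁ (class m j))) t)))
                (class-sum m (λ r' → apply s (K (latin r r') t)) (apply-zero s (latin-sum (λ r → K r t) (K-sum t) r)))
      ; col-zero = λ j t → let (r' , s') = class m j in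
          class-sum k (λ r → apply s' (K (latin r r') t))
            (apply-zero s' (trans (cong₂ _+ᶻ_ (cong₂ _+ᶻ_ (swap 0F r' t) (swap 1F r' t)) (swap 2F r' t))
                                  (latin-sum (λ r → K r t) (K-sum t) r')))
      }
      where
      swap : ∀ r r' t → K (latin r r') t ≡ K (latin r' r) t
      swap r r' t = cong (λ q → K q t) (latin-comm r r')
      apply-zero : ∀ s {x y z} → x +ᶻ y +ᶻ z ≡ 0ℤ → apply s x +ᶻ apply s y +ᶻ apply s z ≡ 0ℤ
      apply-zero plus  eq = eq
      apply-zero minus {x} {y} {z} eq = trans (factor x y z) (cong -ᶻ_ eq)
        where
        factor : ∀ x y z → -ᶻ x +ᶻ -ᶻ y +ᶻ -ᶻ z ≡ -ᶻ (x +ᶻ y +ᶻ z)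
        factor = solve-∀

    κ-exhausts : ∀ i j → Exhausts (κ i j)
    κ-exhausts i j = apply-exhausts (proj₂ (class k i))
      (apply-exhausts (proj₂ (class m j)) (K-exhausts (latin (proj₁ (class k i)) (proj₁ (class m j)))))

    inflateByKotzig : ∀ M → (3 + k * 2) * (3 + m * 2) ≡ suc (M + M) →
                      Block ⊤ (3 + k * 2) (3 + m * 2) (_≤ M) →
                      MR ((3 + k * 2) * c) ((3 + m * 2) * c) (3 + m * 2) (3 + k * 2)
    inflateByKotzig M size B = inflate M d size B kotzigMatrix κ-exhausts

-- The odd case with c = 1

module SpecialColumns (E⁻ o⁻ : ℕ) where

  data Special : ℕ → Set where
    is-0 : Special 0
    is-1 : Special 1
    is-2 : Special 2
    is-3 : Special 3
    is-E-1 : Special E⁻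
    is-E : Special (suc E⁻)
    is-E+1 : Special (2 + E⁻)
    is-o-1 : Special o⁻
    is-o : Special (suc o⁻)
    is-o+1 : Special (2 + o⁻)
    is-o+2 : Special (3 + o⁻)

  -- The columns j = 0, 1, -1, 2, -2, 3, -3, each a permutation of (C - j / 2, j, -C - j / 2), where
  -- C = E = E⁻ + 1 for even j and C = o⁻ + 3 / 2 for odd j.
  special : Block ⊤ 3 7 Special
  special = record
    { matrix = record
      { entry    = λ i j _ → cells i j
      ; row-zero = λ { 0F _ → row0 (+ E⁻) (+ o⁻) ; 1F _ → row1 (+ E⁻) (+ o⁻) ; 2F _ → row2 (+ E⁻) (+ o⁻) }
      ; col-zero = λ { 0F _ → col0 (+ E⁻) (+ o⁻) ; 1F _ → col1 (+ E⁻) (+ o⁻) ; 2F _ → col2 (+ E⁻) (+ o⁻) ; 3F _ → col3 (+ E⁻) (+ o⁻) ; 4F _ → col4 (+ E⁻) (+ o⁻) ; 5F _ → col5 (+ E⁻) (+ o⁻) ; 6F _ → col6 (+ E⁻) (+ o⁻) }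
      }
    ; covers = λ v p → covered v p refl
    }
    where
    cells : Fin 3 → Fin 7 → ℤ
    cells 0F 0F = + (suc E⁻)
    cells 0F 1F = + (1)
    cells 0F 2F = + (2 + o⁻)
    cells 0F 3F = + (2)
    cells 0F 4F = -ᶻ (+ (E⁻))
    cells 0F 5F = -ᶻ (+ (3 + o⁻))
    cells 0F 6F = -ᶻ (+ (3))
    cells 1F 0F = + (0)
    cells 1F 1F = -ᶻ (+ (2 + o⁻))
    cells 1F 2F = -ᶻ (+ (suc o⁻))
    cells 1F 3F = -ᶻ (+ (2 + E⁻))
    cells 1F 4F = + (2 + E⁻)
    cells 1F 5F = + (o⁻)
    cells 1F 6F = + (3 + o⁻)
    cells 2F 0F = -ᶻ (+ (suc E⁻))
    cells 2F 1F = + (suc o⁻)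
    cells 2F 2F = -ᶻ (+ (1))
    cells 2F 3F = + (E⁻)
    cells 2F 4F = -ᶻ (+ (2))
    cells 2F 5F = + (3)
    cells 2F 6F = -ᶻ (+ (o⁻))
    row0 : ∀ e o → (+ 1 +ᶻ e) +ᶻ (+ 1 +ᶻ ((+ 2 +ᶻ o) +ᶻ (+ 2 +ᶻ (-ᶻ e +ᶻ (-ᶻ (+ 3 +ᶻ o) +ᶻ (-ᶻ (+ 3) +ᶻ 0ℤ)))))) ≡ 0ℤ
    row0 = solve-∀
    row1 : ∀ e o → 0ℤ +ᶻ (-ᶻ (+ 2 +ᶻ o) +ᶻ (-ᶻ (+ 1 +ᶻ o) +ᶻ (-ᶻ (+ 2 +ᶻ e) +ᶻ ((+ 2 +ᶻ e) +ᶻ (o +ᶻ ((+ 3 +ᶻ o) +ᶻ 0ℤ)))))) ≡ 0ℤ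
    row1 = solve-∀
    row2 : ∀ e o → -ᶻ (+ 1 +ᶻ e) +ᶻ ((+ 1 +ᶻ o) +ᶻ (-ᶻ (+ 1) +ᶻ (e +ᶻ (-ᶻ (+ 2) +ᶻ (+ 3 +ᶻ (-ᶻ o +ᶻ 0ℤ)))))) ≡ 0ℤ
    row2 = solve-∀
    col0 : ∀ e o → (+ 1 +ᶻ e) +ᶻ (0ℤ +ᶻ (-ᶻ (+ 1 +ᶻ e) +ᶻ 0ℤ)) ≡ 0ℤ
    col0 = solve-∀
    col1 : ∀ e o → + 1 +ᶻ (-ᶻ (+ 2 +ᶻ o) +ᶻ ((+ 1 +ᶻ o) +ᶻ 0ℤ)) ≡ 0ℤ
    col1 = solve-∀
    col2 : ∀ e o → (+ 2 +ᶻ o) +ᶻ (-ᶻ (+ 1 +ᶻ o) +ᶻ (-ᶻ (+ 1) +ᶻ 0ℤ)) ≡ 0ℤ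
    col2 = solve-∀
    col3 : ∀ e o → + 2 +ᶻ (-ᶻ (+ 2 +ᶻ e) +ᶻ (e +ᶻ 0ℤ)) ≡ 0ℤ
    col3 = solve-∀
    col4 : ∀ e o → -ᶻ e +ᶻ ((+ 2 +ᶻ e) +ᶻ (-ᶻ (+ 2) +ᶻ 0ℤ)) ≡ 0ℤ
    col4 = solve-∀
    col5 : ∀ e o → -ᶻ (+ 3 +ᶻ o) +ᶻ (o +ᶻ (+ 3 +ᶻ 0ℤ)) ≡ 0ℤ
    col5 = solve-∀
    col6 : ∀ e o → -ᶻ (+ 3) +ᶻ ((+ 3 +ᶻ o) +ᶻ (-ᶻ o +ᶻ 0ℤ)) ≡ 0ℤ
    col6 = solve-∀
    Hits : ℤ → Set
    Hits v = ∃ λ i → ∃ λ j → ∃ λ (t : ⊤) → cells i j ≡ v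
    either : ∀ v {n} → ∣ v ∣ ≡ n → Hits (+ n) → Hits (-ᶻ (+ n)) → Hits v
    either v {n} eq hit⁺ hit⁻ = [ (λ v≡ → subst Hits (sym v≡) hit⁺) , (λ v≡ → subst Hits (sym v≡) hit⁻) ]′
      (∣i∣≡∣j∣⇒i≡±j v (+ n) eq)
    covered : ∀ v {n} → Special n → ∣ v ∣ ≡ n → Hits v
    covered v is-0 eq = either v eq (1F , 0F , tt , refl) (1F , 0F , tt , refl)
    covered v is-1 eq = either v eq (0F , 1F , tt , refl) (2F , 2F , tt , refl)
    covered v is-2 eq = either v eq (0F , 3F , tt , refl) (2F , 4F , tt , refl)
    covered v is-3 eq = either v eq (2F , 5F , tt , refl) (0F , 6F , tt , refl)
    covered v is-E-1 eq = either v eq (2F , 3F , tt , refl) (0F , 4F , tt , refl)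
    covered v is-E eq = either v eq (0F , 0F , tt , refl) (2F , 0F , tt , refl)
    covered v is-E+1 eq = either v eq (1F , 4F , tt , refl) (1F , 3F , tt , refl)
    covered v is-o-1 eq = either v eq (1F , 5F , tt , refl) (2F , 6F , tt , refl)
    covered v is-o eq = either v eq (2F , 1F , tt , refl) (1F , 2F , tt , refl)
    covered v is-o+1 eq = either v eq (0F , 2F , tt , refl) (1F , 1F , tt , refl)
    covered v is-o+2 eq = either v eq (1F , 6F , tt , refl) (0F , 5F , tt , refl)

data Triple (x y z : ℕ) : ℕ → Set where
  is-x : Triple x y z x
  is-y : Triple x y z y
  is-z : Triple x y z z

triple : ∀ {x y z δ} → + x +ᶻ + y -ᶻ + z ≡ δ → Strip ⊤ 3 δ (Triple x y z)
triple {x} {y} {z} {δ} eq = weakenˢ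
  (λ { n is-x → 0F , tt , refl ; n is-y → 1F , tt , refl ; n is-z → 2F , tt , ℤ.∣-i∣≡∣i∣ (+ z) })
  (strip items (λ _ → trans (assoc (+ x) (+ y) (+ z)) eq))
  where
  items : Fin 3 → ⊤ → ℤ
  items 0F _ = + x
  items 1F _ = + y
  items 2F _ = -ᶻ + z
  assoc : ∀ x y z → x +ᶻ (y +ᶻ (-ᶻ z +ᶻ 0ℤ)) ≡ x +ᶻ y -ᶻ z
  assoc = solve-∀

-- The bounds make `k₁` and `k₂` the upper and lower halves of their sum, hence the numbers of even
-- and odd x below it.
interleave : ∀ k₁ k₂ → k₂ ≤ k₁ → k₁ ≤ suc k₂ → ∀ x → x < k₁ + k₂ →
             (∃ λ (s : Fin k₁) → x ≡ 2 * toℕ s) ⊎ (∃ λ (s : Fin k₂) → x ≡ 1 + 2 * toℕ s)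
interleave k₁ k₂ k₂≤k₁ k₁≤1+k₂ x x< with parity x
... | twice s = inj₁ (fromℕ< s<k₁ , trans (double s) (cong (_*_ 2) (sym (Fin.toℕ-fromℕ< s<k₁))))
  where
  double : ∀ s → s + s ≡ 2 * s
  double = ℕ-Solver.solve-∀
  s<k₁ : s < k₁
  s<k₁ = half-< {s} {k₁} (ℕ.<-≤-trans x< (ℕ.+-monoʳ-≤ k₁ k₂≤k₁))
... | suc-twice s = inj₂ (fromℕ< s<k₂ , trans (double s) (cong (λ s → 1 + 2 * s) (sym (Fin.toℕ-fromℕ< s<k₂))))
  where
  double : ∀ s → suc (s + s) ≡ 1 + 2 * s
  double = ℕ-Solver.solve-∀
  s<k₂ : s < k₂
  s<k₂ = half-< {s} {k₂} (ℕ.≤-pred (ℕ.≤-trans x< (ℕ.+-monoˡ-≤ k₂ k₁≤1+k₂)))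

negate : ∀ {T b σ P} → Strip T b σ P → Strip T b (-ᶻ σ) P
negate S = record
  { item  = λ j t → -ᶻ item S j t
  ; total = λ t → trans (∑-neg (λ j → item S j t)) (cong -ᶻ_ (total S t))
  ; reach = λ n p → let (j , t , eq) = reach S n p in j , t , trans (ℤ.∣-i∣≡∣i∣ (item S j t)) eq
  }

Interval : ℕ → ℕ → ℕ → Set
Interval y w v = ∃ λ r → r < w × v ≡ y + r

cut : ∀ a {b} x → x < a + b → (∃ λ (s : Fin a) → x ≡ toℕ s) ⊎ (∃ λ (u : Fin b) → x ≡ a + toℕ u)
cut zero    x       x<       = inj₂ (fromℕ< x< , sym (Fin.toℕ-fromℕ< x<))
cut (suc a) zero    x<       = inj₁ (zero , refl)
cut (suc a) (suc x) (s≤s x<) with cut a x x<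
... | inj₁ (s , eq) = inj₁ (suc s , cong suc eq)
... | inj₂ (u , eq) = inj₂ (u , cong suc eq)

-- The core uses the triples of the indices 1, …, e + f, of which e are even and f are odd, and the
-- k₁ + k₂ strips use the next indices. E and o + 1 / 2 are the centres of the two nests of pairs,
-- and R is the first number outside the triples.
module OddCase (e' f' k₁ k₂ : ℕ) (f'≤e' : f' ≤ e') (e'≤1+f' : e' ≤ suc f') (k₂≤k₁ : k₂ ≤ k₁) (k₁≤1+k₂ : k₁ ≤ suc k₂)
  where

  -- The special columns use the even index 2 and the odd indices 1 and 3, hence `1 + e'` and
  -- `2 + f'`. The largest index is `n`; the nests around `E` and `o` + 1 / 2 fill
  -- [n + 1, n + 1 + 2 h] and [n + 2 h + 2, R - 1]. Each strip has `W` cells besides its triple.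
  e f h g n E o⁻ o W R : ℕ
  e  = 1 + e'
  f  = 2 + f'
  h  = e + k₁
  g  = f + k₂
  n  = h + g
  E  = suc n + h
  o⁻ = n + h + h + g
  o  = suc o⁻
  W  = 4 + (e' * 2 + f' * 2)
  R  = suc o + g

  -- Written so that `suc M` is the sum of the segment lengths in `all-covered`.
  M : ℕ
  M = 3 + ((e' + f') + ((k₁ + k₂) + (h + (suc h + (g + (g + (k₁ + k₂) * W))))))

  size : (3 + (k₁ * 2 + k₂ * 2)) * (7 + (e' * 2 + f' * 2)) ≡ suc (M + M)
  size = expand e' f' k₁ k₂
    where
    expand : ∀ e' f' k₁ k₂ → (3 + (k₁ * 2 + k₂ * 2)) * (7 + (e' * 2 + f' * 2)) ≡
      suc ((3 + ((e' + f') + ((k₁ + k₂) + (((1 + e') + k₁) + (suc ((1 + e') + k₁)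
             + (((2 + f') + k₂) + (((2 + f') + k₂) + (k₁ + k₂) * (4 + (e' * 2 + f' * 2))))))))) +
           (3 + ((e' + f') + ((k₁ + k₂) + (((1 + e') + k₁) + (suc ((1 + e') + k₁)
             + (((2 + f') + k₂) + (((2 + f') + k₂) + (k₁ + k₂) * (4 + (e' * 2 + f' * 2))))))))))
    expand = ℕ-Solver.solve-∀

  -- In a strip the index e + f + 1 + 2 s meets a pair of difference 2 (e + 1 + s), a defect `δ` = f
  -- - e - 1 for every s. For the odd differences the defect is -δ, so there the tail is negated.
  module _ {δ : ℤ} (δ-def : + f -ᶻ + suc e ≡ δ)
    (tail : ∀ y → Strip ⊤ W (-ᶻ δ) (Interval y W)) where

    open SpecialColumns (n + h) o⁻

    -- Lower and upper number of the pairs with difference 2 i and 2 i + 1.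
    E-pair o-pair : ℕ → ℕ → ℕ → Set
    E-pair x i = Triple x (E ∸ i) (E + i)
    o-pair x i = Triple x (o ∸ i) (suc o + i)

    -- The bound `i ≤ E` keeps `E ∸ i` from being truncated, so that the pair has difference 2 i.
    E-triple : ∀ x i {δ} → i ≤ E → + x -ᶻ + (2 * i) ≡ δ → Strip ⊤ 3 δ (E-pair x i)
    E-triple x i i≤E eq = triple (trans (from-lower (E ∸ i) E (ℕ.m∸n+n≡m i≤E)) eq)
      where
      identity : ∀ x y i → x +ᶻ y -ᶻ (y +ᶻ i +ᶻ i) ≡ x -ᶻ (i +ᶻ (i +ᶻ 0ℤ))
      identity = solve-∀
      from-lower : ∀ y E → y + i ≡ E → + x +ᶻ + y -ᶻ + (E + i) ≡ + x -ᶻ + (2 * i)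
      from-lower y _ refl = identity (+ x) (+ y) (+ i)

    o-triple : ∀ x i {δ} → i ≤ o → + x -ᶻ + (1 + 2 * i) ≡ δ → Strip ⊤ 3 δ (o-pair x i)
    o-triple x i i≤o eq = triple (trans (from-lower (o ∸ i) o (ℕ.m∸n+n≡m i≤o)) eq)
      where
      identity : ∀ x y i → x +ᶻ y -ᶻ (+ 1 +ᶻ (y +ᶻ i) +ᶻ i) ≡ x -ᶻ (+ 1 +ᶻ (i +ᶻ (i +ᶻ 0ℤ)))
      identity = solve-∀
      from-lower : ∀ y o → y + i ≡ o → + x +ᶻ + y -ᶻ + (suc o + i) ≡ + x -ᶻ + (1 + 2 * i)
      from-lower y _ refl = identity (+ x) (+ y) (+ i)

    h≤E : h ≤ E
    h≤E = ℕ.m≤n+m h (suc n)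

    g≤o : g ≤ o
    g≤o = ℕ.≤-trans (ℕ.m≤n+m g (n + h + h)) (ℕ.n≤1+n _)

    core-E≤ : ∀ (s : Fin e') → 2 + toℕ s ≤ h
    core-E≤ s = s≤s (ℕ.≤-trans (Fin.toℕ<n s) (ℕ.m≤m+n e' k₁))

    core-o≤ : ∀ (s : Fin f') → 2 + toℕ s ≤ g
    core-o≤ s = ℕ.+-monoʳ-≤ 2 (ℕ.≤-trans (ℕ.<⇒≤ (Fin.toℕ<n s)) (ℕ.m≤m+n f' k₂))

    strip-E≤ : ∀ (s : Fin k₁) → suc e + toℕ s ≤ h
    strip-E≤ s = subst (_≤ h) (ℕ.+-suc e (toℕ s)) (ℕ.+-monoʳ-≤ e (Fin.toℕ<n s))

    strip-o≤ : ∀ (s : Fin k₂) → f + toℕ s ≤ g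
    strip-o≤ s = ℕ.+-monoʳ-≤ f (ℕ.<⇒≤ (Fin.toℕ<n s))

    -- Transposing the two opposite rows gives the columns j and -j, which cancel in each core row.
    -- The indices start at j = 4 because j = 2 is special.
    core-E : ∀ (s : Fin e') → Block ⊤ 3 2 (E-pair (2 * (2 + toℕ s)) (2 + toℕ s))
    core-E s = transpose (mirror (E-triple _ (2 + toℕ s) (ℕ.≤-trans (core-E≤ s) h≤E)
      (ℤ.+-inverseʳ (+ (2 * (2 + toℕ s))))))

    core-o : ∀ (s : Fin f') → Block ⊤ 3 2 (o-pair (1 + 2 * (2 + toℕ s)) (2 + toℕ s))
    core-o s = transpose (mirror (o-triple _ (2 + toℕ s) (ℕ.≤-trans (core-o≤ s) g≤o)
      (ℤ.+-inverseʳ (+ (1 + 2 * (2 + toℕ s))))))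

    closed : ∀ {P} δ → Strip ⊤ (3 + W) (δ +ᶻ -ᶻ δ) P → Block ⊤ 2 (3 + W) P
    closed δ S = mirror (subst (λ σ → Strip ⊤ (3 + W) σ _) (ℤ.+-inverseʳ δ) S)

    E-index o-index : ℕ → ℕ
    E-index s = suc (e + f) + 2 * s
    o-index s = suc (e + f) + (1 + 2 * s)

    strip-E : ∀ (s : Fin k₁) → Block ⊤ 2 (3 + W)
      (λ v → E-pair (E-index (toℕ s)) (suc e + toℕ s) v ⊎ Interval (R + W * toℕ s) W v)
    strip-E s = closed δ (join
      (E-triple (E-index (toℕ s)) (suc e + toℕ s) (ℕ.≤-trans (strip-E≤ s) h≤E)
        (trans (identity (+ e) (+ f) (+ toℕ s)) δ-def))
      (tail (R + W * toℕ s)))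
      where
      identity : ∀ e f s → + 1 +ᶻ (e +ᶻ f) +ᶻ (s +ᶻ (s +ᶻ 0ℤ)) -ᶻ ((+ 1 +ᶻ e +ᶻ s) +ᶻ (+ 1 +ᶻ e +ᶻ s +ᶻ 0ℤ)) ≡ f -ᶻ (+ 1 +ᶻ e)
      identity = solve-∀

    strip-o : ∀ (s : Fin k₂) → Block ⊤ 2 (3 + W)
      (λ v → o-pair (o-index (toℕ s)) (f + toℕ s) v ⊎ Interval (R + W * (k₁ + toℕ s)) W v)
    strip-o s = closed (-ᶻ δ) (join
      (o-triple (o-index (toℕ s)) (f + toℕ s) (ℕ.≤-trans (strip-o≤ s) g≤o)
        (trans (identity (+ e) (+ f) (+ toℕ s)) (cong -ᶻ_ δ-def)))
      (negate (tail (R + W * (k₁ + toℕ s)))))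
      where
      identity : ∀ e f s → + 1 +ᶻ (e +ᶻ f) +ᶻ (+ 1 +ᶻ (s +ᶻ (s +ᶻ 0ℤ))) -ᶻ (+ 1 +ᶻ ((f +ᶻ s) +ᶻ (f +ᶻ s +ᶻ 0ℤ)))
                 ≡ -ᶻ (f -ᶻ (+ 1 +ᶻ e))
      identity = solve-∀

    Whole : ℕ → Set
    Whole v =
      (Special v ⊎ ((∃ λ (s : Fin e') → E-pair (2 * (2 + toℕ s)) (2 + toℕ s) v)
                 ⊎ (∃ λ (s : Fin f') → o-pair (1 + 2 * (2 + toℕ s)) (2 + toℕ s) v)))
      ⊎ ((∃ λ (s : Fin k₁) → E-pair (E-index (toℕ s)) (suc e + toℕ s) v ⊎ Interval (R + W * toℕ s) W v)
      ⊎ (∃ λ (s : Fin k₂) → o-pair (o-index (toℕ s)) (f + toℕ s) v ⊎ Interval (R + W * (k₁ + toℕ s)) W v))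

    whole : Block ⊤ (3 + (k₁ * 2 + k₂ * 2)) (7 + (e' * 2 + f' * 2)) Whole
    whole = above (beside special (beside (line e' core-E) (line f' core-o))) (above (pile k₁ strip-E) (pile k₂ strip-o))

    by-special : ∀ {v} → Special v → Whole v
    by-special = inj₁ ∘ inj₁

    by-core-E : ∀ s {v} → E-pair (2 * (2 + toℕ s)) (2 + toℕ s) v → Whole v
    by-core-E s p = inj₁ (inj₂ (inj₁ (s , p)))

    by-core-o : ∀ s {v} → o-pair (1 + 2 * (2 + toℕ s)) (2 + toℕ s) v → Whole v
    by-core-o s p = inj₁ (inj₂ (inj₂ (s , p)))

    by-strip-E : ∀ s {v} → E-pair (E-index (toℕ s)) (suc e + toℕ s) v → Whole v
    by-strip-E s p = inj₂ (inj₁ (s , inj₁ p))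

    by-strip-o : ∀ s {v} → o-pair (o-index (toℕ s)) (f + toℕ s) v → Whole v
    by-strip-o s p = inj₂ (inj₂ (s , inj₁ p))

    -- From the centre outwards, the pairs belong to the special columns, then to the core, then to
    -- the strips. One pair around `E` is special, and two around `o` + 1 / 2.
    E-covered : ∀ i → i < h → Whole (E ∸ suc i) × Whole (E + suc i)
    E-covered i i<h with cut e i i<h
    ... | inj₁ (0F , refl)    = by-special is-E-1 , subst Whole (ℕ.+-comm 1 E) (by-special is-E+1)
    ... | inj₁ (suc s , refl) = by-core-E s is-y , by-core-E s is-z
    ... | inj₂ (u , refl)     = by-strip-E u is-y , by-strip-E u is-z

    o-covered : ∀ i → i < g → Whole (o ∸ i) × Whole (suc o + i)
    o-covered i i<g with cut f i i<g
    ... | inj₁ (0F , refl)          = by-special is-o , subst Whole (sym (ℕ.+-identityʳ (suc o))) (by-special is-o+1)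
    ... | inj₁ (1F , refl)          = by-special is-o-1 , subst Whole (ℕ.+-comm 1 (suc o)) (by-special is-o+2)
    ... | inj₁ (suc (suc s) , refl) = by-core-o s is-y , by-core-o s is-z
    ... | inj₂ (u , refl)           = by-strip-o u is-y , by-strip-o u is-z

    core-index-covered : ∀ x → x < e' + f' → Whole (4 + x)
    core-index-covered x x< with interleave e' f' f'≤e' e'≤1+f' x x<
    ... | inj₁ (s , refl) = subst Whole (index (toℕ s)) (by-core-E s is-x)
      where
      index : ∀ s → 2 * (2 + s) ≡ 4 + 2 * s
      index = ℕ-Solver.solve-∀
    ... | inj₂ (s , refl) = subst Whole (index (toℕ s)) (by-core-o s is-x)
      where
      index : ∀ s → 1 + 2 * (2 + s) ≡ 4 + (1 + 2 * s)
      index = ℕ-Solver.solve-∀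

    strip-index-covered : ∀ x → x < k₁ + k₂ → Whole (suc (e + f) + x)
    strip-index-covered x x< with interleave k₁ k₂ k₂≤k₁ k₁≤1+k₂ x x<
    ... | inj₁ (s , refl) = by-strip-E s is-x
    ... | inj₂ (s , refl) = by-strip-o s is-x

    below-E-covered : ∀ w → w < h → Whole (suc n + w)
    below-E-covered w w<h = subst Whole lower (proj₁ (E-covered i i<h))
      where
      -- `w` counts upwards from the bottom of the nest, `i` downwards from its centre.
      i = h ∸ suc w
      h≡ : suc w + i ≡ h
      h≡ = ℕ.m+[n∸m]≡n w<h
      i<h : i < h
      i<h = subst (i <_) h≡ (s≤s (ℕ.m≤n+m i w))
      lower : E ∸ suc i ≡ suc n + w
      lower = trans (cong (_∸ suc i) (trans (cong (_+_ (suc n)) (sym h≡)) (regroup n w i))) (ℕ.m+n∸n≡m (suc n + w) (suc i))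
        where
        regroup : ∀ n w i → suc n + (suc w + i) ≡ suc n + w + suc i
        regroup = ℕ-Solver.solve-∀

    from-E-covered : ∀ w → w < suc h → Whole (E + w)
    from-E-covered zero    _         = subst Whole (sym (ℕ.+-identityʳ E)) (by-special is-E)
    from-E-covered (suc i) (s≤s i<h) = proj₂ (E-covered i i<h)

    below-o-covered : ∀ w → w < g → Whole (E + suc h + w)
    below-o-covered w w<g = subst Whole lower (proj₁ (o-covered i i<g))
      where
      i = g ∸ suc w
      g≡ : suc w + i ≡ g
      g≡ = ℕ.m+[n∸m]≡n w<g
      i<g : i < g
      i<g = subst (i <_) g≡ (s≤s (ℕ.m≤n+m i w))
      lower : o ∸ i ≡ E + suc h + w
      lower = trans (cong (_∸ i) (trans (cong (λ g → suc (n + h + h + g)) (sym g≡)) (regroup n h w i)))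
                    (ℕ.m+n∸n≡m (E + suc h + w) i)
        where
        regroup : ∀ n h w i → suc (n + h + h + (suc w + i)) ≡ (suc n + h + suc h + w) + i
        regroup = ℕ-Solver.solve-∀

    tails-covered : ∀ x → x < (k₁ + k₂) * W → Whole (R + x)
    tails-covered x x< with divide (k₁ + k₂) W x<
    ... | u , r , refl with cut k₁ (toℕ u) (Fin.toℕ<n u)
    ...   | inj₁ (s , eq) = inj₂ (inj₁ (s , inj₂ (toℕ r , Fin.toℕ<n r ,
              trans (cong (λ u → R + (W * u + toℕ r)) eq) (sym (ℕ.+-assoc R (W * toℕ s) (toℕ r))))))
    ...   | inj₂ (s , eq) = inj₂ (inj₂ (s , inj₂ (toℕ r , Fin.toℕ<n r ,
              trans (cong (λ u → R + (W * u + toℕ r)) eq) (sym (ℕ.+-assoc R (W * (k₁ + toℕ s)) (toℕ r))))))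

    -- Consecutive segments exhaust the numbers: 0 to 3, the other core indices, the strip indices,
    -- the lower and upper halves of the nest around `E`, those of the nest around `o` + 1 / 2, and
    -- the tails.
    all-covered : ∀ v → v < suc M → Whole v
    all-covered =
      segment 4 0 refl small (
      segment (e' + f') 4 refl core-index-covered (
      segment (k₁ + k₂) (suc (e + f)) (start₁ e' f') strip-index-covered (
      segment h (suc n) (start₂ e f k₁ k₂) below-E-covered (
      segment (suc h) E refl from-E-covered (
      segment g (E + suc h) refl below-o-covered (
      segment g (suc o) (start₃ n h g) (λ i i<g → proj₂ (o-covered i i<g)) (
      tails-covered)))))))
      where
      -- `start` is the running total of the lengths, `start'` the form in which the coverage lemma
      -- names the same number.
      segment : ∀ {start} a start' {b} → start ≡ start' → (∀ x → x < a → Whole (start' + x)) →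
                (∀ x → x < b → Whole (start' + a + x)) → ∀ x → x < a + b → Whole (start + x)
      segment {start} a _ refl here later x x< with cut a x x<
      ... | inj₁ (s , refl) = here (toℕ s) (Fin.toℕ<n s)
      ... | inj₂ (u , refl) = subst Whole (ℕ.+-assoc start a (toℕ u)) (later (toℕ u) (Fin.toℕ<n u))
      small : ∀ x → x < 4 → Whole x
      small 0 _ = by-special is-0
      small 1 _ = by-special is-1
      small 2 _ = by-special is-2
      small 3 _ = by-special is-3
      small (suc (suc (suc (suc x)))) (s≤s (s≤s (s≤s (s≤s ()))))
      start₁ : ∀ e' f' → 4 + (e' + f') ≡ suc ((1 + e') + (2 + f'))
      start₁ = ℕ-Solver.solve-∀
      start₂ : ∀ e f k₁ k₂ → suc (e + f) + (k₁ + k₂) ≡ suc ((e + k₁) + (f + k₂))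
      start₂ = ℕ-Solver.solve-∀
      start₃ : ∀ n h g → suc n + h + suc h + g ≡ suc (suc (n + h + h + g))
      start₃ = ℕ-Solver.solve-∀

    oddBlock : Block ⊤ (3 + (k₁ * 2 + k₂ * 2)) (7 + (e' * 2 + f' * 2)) (_≤ M)
    oddBlock = weaken (λ v v≤M → all-covered v (s≤s v≤M)) whole

-- Small odd sizes by explicit tables.

module _ {a b} (table : Vec (Vec ℤ b) a) (M : ℕ) where

  cell : Fin a → Fin b → ⊤ → ℤ
  cell i j _ = lookup (lookup table i) j

  -- The three conditions are decided by evaluation, so for a concrete table `_` fills them in.
  fromTable : True (Fin.all? (λ i → ∑ (λ j → cell i j tt) ℤ.≟ 0ℤ)) →
              True (Fin.all? (λ j → ∑ (λ i → cell i j tt) ℤ.≟ 0ℤ)) →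
              True (Fin.all? {suc M} (λ x →
                Fin.any? (λ i → Fin.any? (λ j → cell i j tt ℤ.≟ + toℕ x)) ×-dec
                Fin.any? (λ i → Fin.any? (λ j → cell i j tt ℤ.≟ -ᶻ + toℕ x)))) →
              Block ⊤ a b (_≤ M)
  fromTable rows cols found = record
    { matrix = record
      { entry    = cell
      ; row-zero = λ i _ → toWitness rows i
      ; col-zero = λ j _ → toWitness cols j
      }
    ; covers = covered
    }
    where
    covered : ∀ v → ∣ v ∣ ≤ M → ∃ λ i → ∃ λ j → ∃ λ t → cell i j t ≡ v
    covered v v≤M with toWitness found (fromℕ< (s≤s v≤M)) | ∣i∣≡∣j∣⇒i≡±j v (+ ∣ v ∣) refl
    ... | (i , j , eq) , _ | inj₁ v≡ = i , j , tt ,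
      trans eq (trans (cong +_ (Fin.toℕ-fromℕ< (s≤s v≤M))) (sym v≡))
    ... | _ , (i , j , eq) | inj₂ v≡ = i , j , tt ,
      trans eq (trans (cong (λ n → -ᶻ (+ n)) (Fin.toℕ-fromℕ< (s≤s v≤M))) (sym v≡))

block₃₃ : Block ⊤ 3 3 (_≤ 4)
block₃₃ = fromTable (
  (+ 3    ∷ -[1+ 3 ] ∷ + 1      ∷ []) ∷
  (-[1+ 1 ] ∷ + 0    ∷ + 2      ∷ []) ∷
  (-[1+ 0 ] ∷ + 4    ∷ -[1+ 2 ] ∷ []) ∷ []) 4 _ _ _

block₃₅ : Block ⊤ 3 5 (_≤ 7)
block₃₅ = fromTable (
  (-[1+ 6 ] ∷ -[1+ 5 ] ∷ + 1      ∷ + 5      ∷ + 7      ∷ []) ∷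
  (+ 3      ∷ + 6      ∷ -[1+ 2 ] ∷ -[1+ 0 ] ∷ -[1+ 4 ] ∷ []) ∷
  (+ 4      ∷ + 0      ∷ + 2      ∷ -[1+ 3 ] ∷ -[1+ 1 ] ∷ []) ∷ []) 7 _ _ _

block₅₅ : Block ⊤ 5 5 (_≤ 12)
block₅₅ = fromTable (
  (+ 4      ∷ + 11     ∷ -[1+ 11 ] ∷ -[1+ 4 ]  ∷ + 2      ∷ []) ∷
  (+ 10     ∷ -[1+ 7 ] ∷ -[1+ 5 ]  ∷ + 1       ∷ + 3      ∷ []) ∷
  (-[1+ 8 ] ∷ -[1+ 6 ] ∷ + 0       ∷ + 7       ∷ + 9      ∷ []) ∷
  (-[1+ 2 ] ∷ -[1+ 0 ] ∷ + 6       ∷ + 8       ∷ -[1+ 9 ] ∷ []) ∷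
  (-[1+ 1 ] ∷ + 5      ∷ + 12      ∷ -[1+ 10 ] ∷ -[1+ 3 ] ∷ []) ∷ []) 12 _ _ _

-- Tails of the strips and assembly of the odd blocks.

quad-tail : ∀ w y → Strip ⊤ (w * 4) 0ℤ (Interval y (w * 4))
quad-tail w y = weakenˢ locate (quads id id-affine w (λ r _ → y + 4 * toℕ r))
  where
  locate : ∀ n → Interval y (w * 4) n →
           ∃ λ (r : Fin w) → ∃ λ (t : ⊤) → ∃ λ (k : Fin 4) → n ≡ toℕ k + (y + 4 * toℕ r)
  locate n (x , x< , refl) with divide w 4 x<
  ... | r , k , refl = r , tt , k , rotate y (4 * toℕ r) (toℕ k)
    where
    rotate : ∀ y z k → y + (z + k) ≡ k + (y + z)
    rotate = ℕ-Solver.solve-∀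

step : ∀ y → Strip ⊤ 2 (+ 1) (Interval y 2)
step y = weakenˢ
  (λ { n (0 , _ , refl) → 0F , tt , trans (ℤ.∣-i∣≡∣i∣ (+ y)) (sym (ℕ.+-identityʳ y))
     ; n (1 , _ , refl) → 1F , tt , ℕ.+-comm 1 y
     ; n (suc (suc _) , s≤s (s≤s ()) , _) })
  (strip items (λ _ → difference (+ y)))
  where
  items : Fin 2 → ⊤ → ℤ
  items 0F _ = -ᶻ + y
  items 1F _ = + suc y
  difference : ∀ y → -ᶻ y +ᶻ ((+ 1 +ᶻ y) +ᶻ 0ℤ) ≡ + 1
  difference = solve-∀

-- For an odd number of pairs: one pair of consecutive numbers contributes 1 and the rest splits
-- into groups of four.
step-tail : ∀ w y → Strip ⊤ (2 + w * 4) (+ 1) (Interval y (2 + w * 4))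
step-tail w y = weakenˢ
  (λ { n (0 , _ , eq) → inj₁ (0 , s≤s z≤n , eq)
     ; n (1 , _ , eq) → inj₁ (1 , s≤s (s≤s z≤n) , eq)
     ; n (suc (suc x) , s≤s (s≤s x<) , eq) → inj₂ (x , x< , trans eq (shift y x)) })
  (join (step y) (quad-tail w (2 + y)))
  where
  shift : ∀ y x → y + (2 + x) ≡ 2 + y + x
  shift = ℕ-Solver.solve-∀

CentredBlock : ℕ → ℕ → Set
CentredBlock a b = ∃ λ M → a * b ≡ suc (M + M) × Block ⊤ a b (_≤ M)

record Halving (k : ℕ) : Set where
  constructor halving
  field
    {k₁ k₂}  : ℕ
    k₁+k₂    : k₁ + k₂ ≡ k
    k₂≤k₁    : k₂ ≤ k₁
    k₁≤1+k₂  : k₁ ≤ suc k₂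

halve : ∀ k → Halving k
halve k with parity k
... | twice h     = halving refl ℕ.≤-refl (ℕ.n≤1+n h)
... | suc-twice h = halving {k₁ = suc h} refl (ℕ.n≤1+n h) ℕ.≤-refl

castStrip : ∀ {T b b' σ} {P : ℕ → ℕ → Set} → b ≡ b' → Strip T b σ (P b) → Strip T b' σ (P b')
castStrip refl S = S

-- The `k` strips are halved into `k₁` and `k₂`, the `m` further core indices into `e'` and `f'`. An
-- even `m` gives δ = 0 and tails of groups of four; an odd `m` gives `e'` = `f'` + 1, δ = -1 and
-- tails of total 1.
longBlock : ∀ k m → CentredBlock (3 + k * 2) (7 + m * 2)
longBlock k m with halve k
... | halving {k₁} {k₂} refl k₂≤k₁ k₁≤1+k₂ with parity m
...   | twice h = subst₂ (λ x y → CentredBlock (3 + x) (7 + y))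
        (sym (ℕ.*-distribʳ-+ 2 k₁ k₂)) (sym (ℕ.*-distribʳ-+ 2 h h))
        (M , size , oddBlock (ℤ.+-inverseʳ (+ (2 + h))) tail)
  where
  open OddCase h h k₁ k₂ ℕ.≤-refl (ℕ.n≤1+n h) k₂≤k₁ k₁≤1+k₂ using (W; M; size; oddBlock)
  width : ∀ h → (1 + h) * 4 ≡ 4 + (h * 2 + h * 2)
  width = ℕ-Solver.solve-∀
  tail : ∀ y → Strip ⊤ W 0ℤ (Interval y W)
  tail y = castStrip {P = Interval y} (width h) (quad-tail (1 + h) y)
...   | suc-twice h = subst₂ (λ x y → CentredBlock (3 + x) (7 + y))
        (sym (ℕ.*-distribʳ-+ 2 k₁ k₂)) (sym (ℕ.*-distribʳ-+ 2 (suc h) h))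
        (M , size , oddBlock (predecessor (+ h)) tail)
  where
  open OddCase (suc h) h k₁ k₂ (ℕ.n≤1+n h) ℕ.≤-refl k₂≤k₁ k₁≤1+k₂ using (W; M; size; oddBlock)
  width : ∀ h → 2 + (1 + h) * 4 ≡ 4 + ((1 + h) * 2 + h * 2)
  width = ℕ-Solver.solve-∀
  predecessor : ∀ h → (+ 2 +ᶻ h) -ᶻ (+ 3 +ᶻ h) ≡ -[1+ 0 ]
  predecessor = solve-∀
  tail : ∀ y → Strip ⊤ W (+ 1) (Interval y W)
  tail y = castStrip {P = Interval y} (width h) (step-tail (1 + h) y)

-- From width 7 on there is room for the special columns; below that, `k ≤ m` leaves only 3 × 3, 3 ×
-- 5 and 5 × 5.
centredBlock : ∀ k m → k ≤ m → CentredBlock (3 + k * 2) (3 + m * 2)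
centredBlock zero          zero          _              = 4 , refl , block₃₃
centredBlock zero          (suc zero)    _              = 7 , refl , block₃₅
centredBlock (suc zero)    (suc zero)    _              = 12 , refl , block₅₅
centredBlock k             (suc (suc m)) _              = longBlock k m
centredBlock (suc (suc _)) (suc zero)    (s≤s ())

oddRectangle : ∀ k m d → k ≤ m →
  MR ((3 + k * 2) * suc (d + d)) ((3 + m * 2) * suc (d + d)) (3 + m * 2) (3 + k * 2)
oddRectangle k m d k≤m =
  let (M , area , B) = centredBlock k m k≤m in Kotzig.inflateByKotzig d k m M area B

theorem13 : (a b c : ℕ) → 2 ≤ a → a ≤ b → 1 ≤ c →
    ((Odd a × Odd b × Odd c) ⊎ (Even a × Even b × ¬ ((a ≡ 2) × (b ≡ 2)))) →
    MR (a * c) (b * c) b a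
theorem13 _ _ _ 2≤a _ _ (inj₁ ((zero , refl) , _)) = contradiction 2≤a λ { (s≤s ()) }
theorem13 _ _ _ _ a≤b _ (inj₁ ((suc _ , refl) , (zero , refl) , _)) = contradiction a≤b λ { (s≤s ()) }
theorem13 _ _ _ _ a≤b _ (inj₁ ((suc k , refl) , (suc m , refl) , (d , refl))) =
  subst₂ (λ a b → MR (a * suc (2 * d)) (b * suc (2 * d)) b a) (width k) (width m)
    -- `2 * d` computes to `d + (d + 0)`, so only the trailing 0 has to be introduced.
    (subst (λ e → MR ((3 + k * 2) * suc (d + e)) ((3 + m * 2) * suc (d + e)) (3 + m * 2) (3 + k * 2))
      (sym (ℕ.+-identityʳ d)) (oddRectangle k m d k≤m))
  where
  width : ∀ k → 3 + k * 2 ≡ suc (2 * suc k)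
  width = ℕ-Solver.solve-∀
  k≤m : k ≤ m
  k≤m = ℕ.≤-pred (ℕ.*-cancelˡ-≤ 2 (ℕ.≤-pred a≤b))
theorem13 _ _ c 2≤a a≤b _ (inj₂ ((p , refl) , (q , refl) , ¬2×2)) =
  subst₂ (λ a b → MR (a * c) (b * c) b a) (ℕ.*-comm p 2) (ℕ.*-comm q 2) (evenRectangle p q c (2≤q q a≤b ¬2×2))
  where
  2≤q : ∀ q → 2 * p ≤ 2 * q → ¬ (2 * p ≡ 2 × 2 * q ≡ 2) → 2 ≤ q
  2≤q 0             a≤b _    = contradiction (ℕ.≤-trans 2≤a a≤b) λ ()
  -- Here 2 ≤ a ≤ b = 2 forces a = 2, the excluded pair.
  2≤q 1             a≤b ¬2×2 = contradiction (ℕ.≤-antisym a≤b 2≤a , refl) ¬2×2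
  2≤q (suc (suc _)) _   _    = s≤s (s≤s z≤n)
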